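{- There exists an absolute constant $C>0$ such that for all integers $r,s$ with $2\le r\le s$, $$\frac18 r^2 s\le \tilde r(P_r,P_s)\le C r^2 s(\log s)^3.$$
   Context: An ordered graph on $n$ vertices is a finite simple graph whose vertices are labeled $1,2,\ldots,n$ (equivalently, a finite simple graph with a linear order on its vertices). The ordered path $P_n$ is the monotone increasing path with $n$ edges and $n+1$ vertices; a copy of $P_n$ in an ordered graph $H$ is a sequence of vertices $v_0<v_1<\cdots<v_n$ such that $v_{i-1}v_i$ is an edge of $H$ for every $1\le i\le n$. The ordered size Ramsey number $\tilde r(P_r,P_s)$ is the minimum number $m$ for which there exists an ordered graph $H$ with $m$ edges such that every coloring of the edges of $H$ with the two colors red and blue contains a copy of $P_r$ with all edges red or a copy of $P_s$ with all edges blue. $\log$ is the natural logarithm. -}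

module Defs where

open import Data.Fin.Base using (Fin; suc; inject₁) renaming (_<_ to _<ᶠ_)
open import Data.Integer.Base using (+_; +[1+_]; -[1+_])
import Data.Integer.Base as ℤ
import Data.Integer.Properties as ℤ
open import Data.Nat.Base as ℕ using (ℕ; zero; suc)
import Data.Nat.Properties as ℕ
open import Data.Product.Base using (Σ; ∃; _×_; _,_; proj₁; proj₂)
open import Data.Rational.Base as ℚ using (ℚ; mkℚ; 0ℚ; 1ℚ; ∣_∣)
import Data.Rational.Properties as ℚ
open import Data.Rational.Solver using (module +-*-Solver)
import Data.Rational.Unnormalised.Base as ℚᵘ
import Data.Rational.Unnormalised.Properties as ℚᵘ
open import Data.Sum.Base using (_⊎_; inj₁; inj₂)
open import Function.Definitions using (Injective)
open import Relation.Binary.PropositionalEquality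

------------------------------------------------------------------------
-- Ordered graphs

-- A simple graph on the linearly ordered vertex set Fin n with exactly m
-- edges.  Each edge {u , v}, u < v, is recorded as the pair (u , v);
-- injectivity says that the m edges are pairwise distinct.

record OrderedGraph (n m : ℕ) : Set where
  field
    edge      : Fin m → Fin n × Fin n
    ordered   : ∀ e → proj₁ (edge e) <ᶠ proj₂ (edge e)
    injective : Injective _≡_ _≡_ edge

open OrderedGraph public

data Colour : Set where
  red blue : Colour

-- The ordered path P_k has k edges, hence k + 1 vertices.

record MonochromaticPath {n m : ℕ} (H : OrderedGraph n m)
                         (χ : Fin m → Colour) (c : Colour) (k : ℕ) : Set where
  field
    vertex     : Fin (suc k) → Fin n
    increasing : ∀ i → vertex (inject₁ i) <ᶠ vertex (suc i)
    adjacent   : ∀ i → ∃ λ e →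
                 (edge H e ≡ (vertex (inject₁ i) , vertex (suc i))) × (χ e ≡ c)

Arrows : ∀ {n m} → OrderedGraph n m → ℕ → ℕ → Set
Arrows {m = m} H r s = (χ : Fin m → Colour) →
  MonochromaticPath H χ red r ⊎ MonochromaticPath H χ blue s

SomeGraphArrows : ℕ → ℕ → ℕ → Set
SomeGraphArrows r s m = ∃ λ n → Σ (OrderedGraph n m) λ H → Arrows H r s

-- m = r̃(P_r , P_s).

IsOrderedSizeRamsey : ℕ → ℕ → ℕ → Set
IsOrderedSizeRamsey r s m =
  SomeGraphArrows r s m × (∀ m′ → SomeGraphArrows r s m′ → m ℕ.≤ m′)

------------------------------------------------------------------------
-- Real numbers, as Cauchy sequences of rationals

IsCauchy : (ℕ → ℚ) → Set
IsCauchy x = ∀ ε → 0ℚ ℚ.< ε →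
  ∃ λ N → ∀ m n → N ℕ.≤ m → N ℕ.≤ n → ∣ x m ℚ.- x n ∣ ℚ.≤ ε

record ℝ : Set where
  constructor mkℝ
  field
    seq    : ℕ → ℚ
    cauchy : IsCauchy seq

open ℝ public

infix 4 _≤ℝ_ _<ℝ_

_≤ℝ_ : ℝ → ℝ → Set
x ≤ℝ y = ∀ ε → 0ℚ ℚ.< ε → ∃ λ N → ∀ n → N ℕ.≤ n → seq x n ℚ.≤ seq y n ℚ.+ ε

_<ℝ_ : ℝ → ℝ → Set
x <ℝ y = ∃ λ ε → (0ℚ ℚ.< ε) × ∃ λ N → ∀ n → N ℕ.≤ n → seq x n ℚ.+ ε ℚ.≤ seq y n

fromℚ : ℚ → ℝ
fromℚ q = mkℝ (λ _ → q) λ ε 0<ε → 0 , λ _ _ _ _ →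
  subst (ℚ._≤ ε) (cong ∣_∣ (sym (ℚ.+-inverseʳ q))) (ℚ.<⇒≤ 0<ε)

fromℕ : ℕ → ℝ
fromℕ n = fromℚ (+ n ℚ./ 1)

private
  open +-*-Solver using (solve; _:=_; _:+_; _:-_; _:*_; :-_; con)

  split : ∀ a b → a ≡ a ℚ.- b ℚ.+ b
  split = solve 2 (λ a b → a := a :- b :+ b) refl

  productDifference : ∀ a b c d →
    a ℚ.* b ℚ.- c ℚ.* d ≡ a ℚ.* (b ℚ.- d) ℚ.+ d ℚ.* (a ℚ.- c)
  productDifference =
    solve 4 (λ a b c d → a :* b :- c :* d := a :* (b :- d) :+ d :* (a :- c)) refl

  factor : ∀ a b e i → a ℚ.* (e ℚ.* i) ℚ.+ b ℚ.* (e ℚ.* i) ≡ e ℚ.* ((a ℚ.+ b) ℚ.* i)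
  factor = solve 4 (λ a b e i → a :* (e :* i) :+ b :* (e :* i) := e :* ((a :+ b) :* i)) refl

  regroup : ∀ a b c d → a ℚ.+ b ℚ.+ c ℚ.* (d ℚ.* b) ≡ a ℚ.+ (c ℚ.* d ℚ.+ 1ℚ) ℚ.* b
  regroup = solve 4 (λ a b c d → a :+ b :+ c :* (d :* b) := a :+ (c :* d :+ con 1ℚ) :* b) refl

  cancel : ∀ a b → a ℚ.+ b ℚ.- a ≡ b
  cancel = solve 2 (λ a b → a :+ b :- a := b) refl

  negDifference : ∀ a b → ℚ.- (a ℚ.- b) ≡ b ℚ.- a
  negDifference = solve 2 (λ a b → :- (a :- b) := b :- a) refl

  ∣p∣≤ : ∀ p q → p ℚ.≤ q → ℚ.- p ℚ.≤ q → ∣ p ∣ ℚ.≤ q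
  ∣p∣≤ p q p≤q -p≤q with ℚ.∣p∣≡p∨∣p∣≡-p p
  ... | inj₁ eq = subst (ℚ._≤ q) (sym eq) p≤q
  ... | inj₂ eq = subst (ℚ._≤ q) (sym eq) -p≤q

  eventuallyBounded : ∀ x → IsCauchy x →
    ∃ λ B → (0ℚ ℚ.< B) × ∃ λ N → ∀ n → N ℕ.≤ n → ∣ x n ∣ ℚ.≤ B
  eventuallyBounded x xc with xc 1ℚ (ℚ.positive⁻¹ 1ℚ)
  ... | N , close = B , 0<B , N , λ n N≤n → begin
      ∣ x n ∣                        ≡⟨ cong ∣_∣ (split (x n) (x N)) ⟩
      ∣ (x n ℚ.- x N) ℚ.+ x N ∣      ≤⟨ ℚ.∣p+q∣≤∣p∣+∣q∣ (x n ℚ.- x N) (x N) ⟩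
      ∣ x n ℚ.- x N ∣ ℚ.+ ∣ x N ∣    ≤⟨ ℚ.+-monoˡ-≤ (∣ x N ∣) (close n N N≤n ℕ.≤-refl) ⟩
      B                              ∎
    where
    open ℚ.≤-Reasoning
    B = 1ℚ ℚ.+ ∣ x N ∣
    0<B : 0ℚ ℚ.< B
    0<B = ℚ.+-mono-<-≤ (ℚ.positive⁻¹ 1ℚ) (ℚ.0≤∣p∣ (x N))

  *-mono-≤-nonNeg : ∀ a A b δ → 0ℚ ℚ.≤ A → a ℚ.≤ A → 0ℚ ℚ.≤ b → b ℚ.≤ δ →
                    a ℚ.* b ℚ.≤ A ℚ.* δ
  *-mono-≤-nonNeg a A b δ 0≤A a≤A 0≤b b≤δ = ℚ.≤-trans
    (ℚ.*-monoʳ-≤-nonNeg b {{ℚ.nonNegative 0≤b}} a≤A)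
    (ℚ.*-monoˡ-≤-nonNeg A {{ℚ.nonNegative 0≤A}} b≤δ)

  ∣productDifference∣≤ : ∀ A B δ a b c d → 0ℚ ℚ.≤ A → 0ℚ ℚ.≤ B →
    ∣ a ∣ ℚ.≤ A → ∣ d ∣ ℚ.≤ B → ∣ b ℚ.- d ∣ ℚ.≤ δ → ∣ a ℚ.- c ∣ ℚ.≤ δ →
    ∣ a ℚ.* b ℚ.- c ℚ.* d ∣ ℚ.≤ A ℚ.* δ ℚ.+ B ℚ.* δ
  ∣productDifference∣≤ A B δ a b c d 0≤A 0≤B a≤A d≤B bd≤δ ac≤δ = begin
    ∣ a ℚ.* b ℚ.- c ℚ.* d ∣
      ≡⟨ cong ∣_∣ (productDifference a b c d) ⟩
    ∣ a ℚ.* (b ℚ.- d) ℚ.+ d ℚ.* (a ℚ.- c) ∣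
      ≤⟨ ℚ.∣p+q∣≤∣p∣+∣q∣ (a ℚ.* (b ℚ.- d)) (d ℚ.* (a ℚ.- c)) ⟩
    ∣ a ℚ.* (b ℚ.- d) ∣ ℚ.+ ∣ d ℚ.* (a ℚ.- c) ∣
      ≡⟨ cong₂ ℚ._+_ (ℚ.∣p*q∣≡∣p∣*∣q∣ a (b ℚ.- d)) (ℚ.∣p*q∣≡∣p∣*∣q∣ d (a ℚ.- c)) ⟩
    (∣ a ∣) ℚ.* (∣ b ℚ.- d ∣) ℚ.+ (∣ d ∣) ℚ.* (∣ a ℚ.- c ∣)
      ≤⟨ ℚ.+-mono-≤
           (*-mono-≤-nonNeg (∣ a ∣) A (∣ b ℚ.- d ∣) δ 0≤A a≤A (ℚ.0≤∣p∣ (b ℚ.- d)) bd≤δ)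
           (*-mono-≤-nonNeg (∣ d ∣) B (∣ a ℚ.- c ∣) δ 0≤B d≤B (ℚ.0≤∣p∣ (a ℚ.- c)) ac≤δ) ⟩
    A ℚ.* δ ℚ.+ B ℚ.* δ ∎
    where open ℚ.≤-Reasoning

  divide : ∀ A B ε → 0ℚ ℚ.< A → 0ℚ ℚ.< B → 0ℚ ℚ.< ε →
           ∃ λ δ → (0ℚ ℚ.< δ) × (A ℚ.* δ ℚ.+ B ℚ.* δ ≡ ε)
  divide A B ε 0<A 0<B 0<ε = ε ℚ.* i ,
    ℚ.positive⁻¹ (ε ℚ.* i) {{ℚ.pos*pos⇒pos ε {{ℚ.positive 0<ε}} i {{i>0}}}} ,
    trans (factor A B ε i)
      (trans (cong (ε ℚ.*_) (ℚ.*-inverseʳ K {{K≢0}})) (ℚ.*-identityʳ ε))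
    where
    K = A ℚ.+ B
    K>0 : ℚ.Positive K
    K>0 = ℚ.positive (ℚ.+-mono-< 0<A 0<B)
    K≢0 : ℚ.NonZero K
    K≢0 = ℚ.pos⇒nonZero K {{K>0}}
    i = ℚ.1/_ K {{K≢0}}
    i>0 : ℚ.Positive i
    i>0 = ℚ.1/pos⇒pos K {{K>0}}

  *-cauchy : ∀ x y → IsCauchy x → IsCauchy y → IsCauchy (λ n → x n ℚ.* y n)
  *-cauchy x y xc yc ε 0<ε =
    let A , 0<A , N₁ , x≤A  = eventuallyBounded x xc
        B , 0<B , N₂ , y≤B  = eventuallyBounded y yc
        δ , 0<δ , Aδ+Bδ≡ε   = divide A B ε 0<A 0<B 0<ε
        N₃ , xδ             = xc δ 0<δ
        N₄ , yδ             = yc δ 0<δ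
        N₄≤ = ℕ.m≤n+m N₄ (N₁ ℕ.+ N₂ ℕ.+ N₃)
        N₃≤ = ℕ.m≤n⇒m≤n+o N₄ (ℕ.m≤n+m N₃ (N₁ ℕ.+ N₂))
        N₂≤ = ℕ.m≤n⇒m≤n+o N₄ (ℕ.m≤n⇒m≤n+o N₃ (ℕ.m≤n+m N₂ N₁))
        N₁≤ = ℕ.m≤n⇒m≤n+o N₄ (ℕ.m≤n⇒m≤n+o N₃ (ℕ.m≤m+n N₁ N₂))
    in N₁ ℕ.+ N₂ ℕ.+ N₃ ℕ.+ N₄ , λ m n N≤m N≤n → ℚ.≤-trans
      (∣productDifference∣≤ A B δ (x m) (y m) (x n) (y n) (ℚ.<⇒≤ 0<A) (ℚ.<⇒≤ 0<B)
        (x≤A m (ℕ.≤-trans N₁≤ N≤m)) (y≤B n (ℕ.≤-trans N₂≤ N≤n))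
        (yδ m n (ℕ.≤-trans N₄≤ N≤m) (ℕ.≤-trans N₄≤ N≤n))
        (xδ m n (ℕ.≤-trans N₃≤ N≤m) (ℕ.≤-trans N₃≤ N≤n)))
      (ℚ.≤-reflexive Aδ+Bδ≡ε)

infixl 7 _*ℝ_
infixr 8 _^ℝ_ _^ℚ_

_*ℝ_ : ℝ → ℝ → ℝ
mkℝ x xc *ℝ mkℝ y yc = mkℝ (λ n → x n ℚ.* y n) (*-cauchy x y xc yc)

_^ℝ_ : ℝ → ℕ → ℝ
x ^ℝ zero  = fromℚ 1ℚ
x ^ℝ suc n = x *ℝ (x ^ℝ n)

------------------------------------------------------------------------
-- The natural logarithm of a positive integer

_^ℚ_ : ℚ → ℕ → ℚ
q ^ℚ zero  = 1ℚ
q ^ℚ suc n = q ℚ.* (q ^ℚ n)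

-- From − log (1 − x) = Σ_{k ≥ 1} x ^ k / k with x = 1 − 1/s = p/s, s = p + 1:
--   log s = Σ_{k ≥ 1} (p/s) ^ k / k,
-- where the term of index k below is the one with exponent k + 1.

logTerm : ℕ → ℕ → ℚ
logTerm p k = ((+ p ℚ./ suc p) ^ℚ suc k) ℚ.* (+ 1 ℚ./ suc k)

logPartialSum : ℕ → ℕ → ℚ
logPartialSum p zero    = 0ℚ
logPartialSum p (suc n) = logPartialSum p n ℚ.+ logTerm p n

private
  module LogCauchy (p : ℕ) where
    S : ℕ → ℚ
    S = logPartialSum p
    t : ℕ → ℚ
    t = logTerm p
    x σ : ℚ
    x = + p ℚ./ suc p
    σ = + suc p ℚ./ 1

    /-mono : ∀ a b c d → .{{_ : ℕ.NonZero b}} .{{_ : ℕ.NonZero d}} →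
             a ℕ.* d ℕ.≤ c ℕ.* b → + a ℚ./ b ℚ.≤ + c ℚ./ d
    /-mono a b@(suc _) c d@(suc _) ad≤cb = ℚ.toℚᵘ-cancel-≤ (begin
      ℚ.toℚᵘ (+ a ℚ./ b)  ≃⟨ ℚ.toℚᵘ-fromℚᵘ (+ a ℚᵘ./ b) ⟩
      + a ℚᵘ./ b          ≤⟨ ℚᵘ.*≤* (subst₂ ℤ._≤_ (ℤ.pos-* a d) (ℤ.pos-* c b) (ℤ.+≤+ ad≤cb)) ⟩
      + c ℚᵘ./ d          ≃⟨ ℚ.toℚᵘ-fromℚᵘ (+ c ℚᵘ./ d) ⟨
      ℚ.toℚᵘ (+ c ℚ./ d)  ∎)
      where open ℚᵘ.≤-Reasoning

    0≤/ : ∀ a b → .{{_ : ℕ.NonZero b}} → 0ℚ ℚ.≤ + a ℚ./ b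
    0≤/ a b = ℚ.≤-trans (/-mono 0 1 a b ℕ.z≤n) ℚ.≤-refl

    0≤x : 0ℚ ℚ.≤ x
    0≤x = 0≤/ p (suc p)

    x≤1 : x ℚ.≤ 1ℚ
    x≤1 = /-mono p (suc p) 1 1
      (subst₂ ℕ._≤_ (sym (ℕ.*-identityʳ p)) (sym (ℕ.*-identityˡ (suc p))) (ℕ.n≤1+n p))

    instance
      x-nonNeg : ℚ.NonNegative x
      x-nonNeg = ℚ.nonNegative 0≤x
      σ-nonNeg : ℚ.NonNegative σ
      σ-nonNeg = ℚ.nonNegative (0≤/ (suc p) 1)

    σx+1≡σ : σ ℚ.* x ℚ.+ 1ℚ ≡ σ
    σx+1≡σ = ℚ.toℚᵘ-injective (begin
      ℚ.toℚᵘ (σ ℚ.* x ℚ.+ 1ℚ)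
        ≈⟨ ℚ.toℚᵘ-homo-+ (σ ℚ.* x) 1ℚ ⟩
      ℚ.toℚᵘ (σ ℚ.* x) ℚᵘ.+ ℚᵘ.1ℚᵘ
        ≈⟨ ℚᵘ.+-congˡ ℚᵘ.1ℚᵘ (ℚ.toℚᵘ-homo-* σ x) ⟩
      ℚ.toℚᵘ σ ℚᵘ.* ℚ.toℚᵘ x ℚᵘ.+ ℚᵘ.1ℚᵘ
        ≈⟨ ℚᵘ.+-congˡ ℚᵘ.1ℚᵘ (ℚᵘ.*-cong (ℚ.toℚᵘ-fromℚᵘ (+ suc p ℚᵘ./ 1)) (ℚ.toℚᵘ-fromℚᵘ (+ p ℚᵘ./ suc p))) ⟩
      (+ suc p ℚᵘ./ 1) ℚᵘ.* (+ p ℚᵘ./ suc p) ℚᵘ.+ ℚᵘ.1ℚᵘ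
        ≈⟨ ℚᵘ.*≡* (arith (+ p) _ _
             (cong +_ (ℕ.*-identityˡ (suc p)))
             (cong +_ (trans (ℕ.*-identityʳ (1 ℕ.* suc p)) (ℕ.*-identityˡ (suc p))))) ⟩
      + suc p ℚᵘ./ 1
        ≈⟨ ℚ.toℚᵘ-fromℚᵘ (+ suc p ℚᵘ./ 1) ⟨
      ℚ.toℚᵘ σ ∎)
      where
      open import Relation.Binary.Reasoning.Setoid ℚᵘ.≃-setoid
      open import Data.Integer.Solver using () renaming (module +-*-Solver to ℤS)
      open ℤS using () renaming (solve to solveℤ; _:=_ to _≐_; _:+_ to _⊕_; _:*_ to _⊗_; con to conℤ)
      arith : ∀ q d d′ → d ≡ + 1 ℤ.+ q → d′ ≡ + 1 ℤ.+ q →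
              ((+ 1 ℤ.+ q) ℤ.* q ℤ.* + 1 ℤ.+ + 1 ℤ.* d) ℤ.* + 1 ≡ (+ 1 ℤ.+ q) ℤ.* d′
      arith q _ _ refl refl = solveℤ 1 (λ q →
        ((conℤ (+ 1) ⊕ q) ⊗ q ⊗ conℤ (+ 1) ⊕ conℤ (+ 1) ⊗ (conℤ (+ 1) ⊕ q)) ⊗ conℤ (+ 1)
        ≐ (conℤ (+ 1) ⊕ q) ⊗ (conℤ (+ 1) ⊕ q)) refl q

    0≤x^ : ∀ k → 0ℚ ℚ.≤ x ^ℚ k
    0≤x^ zero    = ℚ.nonNegative⁻¹ 1ℚ
    0≤x^ (suc k) = ℚ.nonNegative⁻¹ _ {{ℚ.nonNeg*nonNeg⇒nonNeg x (x ^ℚ k) {{ℚ.nonNegative (0≤x^ k)}}}}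

    x^≤1 : ∀ k → x ^ℚ k ℚ.≤ 1ℚ
    x^≤1 zero = ℚ.≤-refl
    x^≤1 (suc k) = begin
      x ℚ.* (x ^ℚ k)  ≤⟨ ℚ.*-monoˡ-≤-nonNeg x (x^≤1 k) ⟩
      x ℚ.* 1ℚ        ≡⟨ ℚ.*-identityʳ x ⟩
      x               ≤⟨ x≤1 ⟩
      1ℚ              ∎
      where open ℚ.≤-Reasoning

    0≤t : ∀ k → 0ℚ ℚ.≤ t k
    0≤t k = ℚ.nonNegative⁻¹ _ {{ℚ.nonNeg*nonNeg⇒nonNeg (x ^ℚ suc k) {{ℚ.nonNegative (0≤x^ (suc k))}}
      (+ 1 ℚ./ suc k) {{ℚ.nonNegative (0≤/ 1 (suc k))}}}}

    t≤1/ : ∀ k → t k ℚ.≤ + 1 ℚ./ suc k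
    t≤1/ k = begin
      t k                       ≤⟨ ℚ.*-monoʳ-≤-nonNeg (+ 1 ℚ./ suc k) {{ℚ.nonNegative (0≤/ 1 (suc k))}} (x^≤1 (suc k)) ⟩
      1ℚ ℚ.* (+ 1 ℚ./ suc k)    ≡⟨ ℚ.*-identityˡ _ ⟩
      + 1 ℚ./ suc k             ∎
      where open ℚ.≤-Reasoning

    t-step : ∀ k → t (suc k) ℚ.≤ x ℚ.* t k
    t-step k = begin
      x ℚ.* (x ^ℚ suc k) ℚ.* (+ 1 ℚ./ suc (suc k))
        ≤⟨ ℚ.*-monoˡ-≤-nonNeg (x ^ℚ suc (suc k)) {{ℚ.nonNegative (0≤x^ (suc (suc k)))}}
             (/-mono 1 (suc (suc k)) 1 (suc k) (ℕ.*-monoʳ-≤ 1 (ℕ.n≤1+n (suc k)))) ⟩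
      x ℚ.* (x ^ℚ suc k) ℚ.* (+ 1 ℚ./ suc k)
        ≡⟨ ℚ.*-assoc x (x ^ℚ suc k) (+ 1 ℚ./ suc k) ⟩
      x ℚ.* t k ∎
      where open ℚ.≤-Reasoning

    U : ℕ → ℚ
    U n = S n ℚ.+ σ ℚ.* t n

    S-step : ∀ n → S n ℚ.≤ S (suc n)
    S-step n = begin
      S n            ≡⟨ ℚ.+-identityʳ (S n) ⟨
      S n ℚ.+ 0ℚ     ≤⟨ ℚ.+-monoʳ-≤ (S n) (0≤t n) ⟩
      S n ℚ.+ t n    ∎
      where open ℚ.≤-Reasoning

    U-step : ∀ n → U (suc n) ℚ.≤ U n
    U-step n = begin
      S n ℚ.+ t n ℚ.+ σ ℚ.* t (suc n)
        ≤⟨ ℚ.+-monoʳ-≤ (S n ℚ.+ t n) (ℚ.*-monoˡ-≤-nonNeg σ (t-step n)) ⟩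
      S n ℚ.+ t n ℚ.+ σ ℚ.* (x ℚ.* t n)
        ≡⟨ regroup (S n) (t n) σ x ⟩
      S n ℚ.+ (σ ℚ.* x ℚ.+ 1ℚ) ℚ.* t n
        ≡⟨ cong (λ h → S n ℚ.+ h ℚ.* t n) σx+1≡σ ⟩
      U n ∎
      where open ℚ.≤-Reasoning

    S≤U : ∀ n → S n ℚ.≤ U n
    S≤U n = begin
      S n            ≡⟨ ℚ.+-identityʳ (S n) ⟨
      S n ℚ.+ 0ℚ     ≤⟨ ℚ.+-monoʳ-≤ (S n) (ℚ.nonNegative⁻¹ _ {{ℚ.nonNeg*nonNeg⇒nonNeg σ (t n) {{ℚ.nonNegative (0≤t n)}}}}) ⟩
      U n            ∎
      where open ℚ.≤-Reasoning

    S-mono : ∀ {N n} → N ℕ.≤′ n → S N ℚ.≤ S n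
    S-mono ℕ.≤′-refl = ℚ.≤-refl
    S-mono (ℕ.≤′-step {n} N≤n) = ℚ.≤-trans (S-mono N≤n) (S-step n)

    U-anti : ∀ {N n} → N ℕ.≤′ n → U n ℚ.≤ U N
    U-anti ℕ.≤′-refl = ℚ.≤-refl
    U-anti (ℕ.≤′-step {n} N≤n) = ℚ.≤-trans (U-step n) (U-anti N≤n)

    difference≤ : ∀ N m n → N ℕ.≤ m → N ℕ.≤ n → S m ℚ.- S n ℚ.≤ σ ℚ.* t N
    difference≤ N m n N≤m N≤n = begin
      S m ℚ.- S n    ≤⟨ ℚ.+-mono-≤ (ℚ.≤-trans (S≤U m) (U-anti (ℕ.≤⇒≤′ N≤m)))
                          (ℚ.neg-antimono-≤ (S-mono (ℕ.≤⇒≤′ N≤n))) ⟩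
      U N ℚ.- S N    ≡⟨ cancel (S N) (σ ℚ.* t N) ⟩
      σ ℚ.* t N      ∎
      where open ℚ.≤-Reasoning

    ∣difference∣≤ : ∀ N m n → N ℕ.≤ m → N ℕ.≤ n → ∣ S m ℚ.- S n ∣ ℚ.≤ σ ℚ.* t N
    ∣difference∣≤ N m n N≤m N≤n = ∣p∣≤ (S m ℚ.- S n) (σ ℚ.* t N)
      (difference≤ N m n N≤m N≤n)
      (ℚ.≤-trans (ℚ.≤-reflexive (negDifference (S m) (S n))) (difference≤ N n m N≤n N≤m))

    archimedean : ∀ ε → 0ℚ ℚ.< ε → ∃ λ N → σ ℚ.* (+ 1 ℚ./ suc N) ℚ.≤ ε
    archimedean (mkℚ -[1+ _ ] _ _)   (ℚ.*<* ())
    archimedean (mkℚ (+ 0) _ _)      (ℚ.*<* (ℤ.+<+ ()))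
    archimedean ε@(mkℚ +[1+ a ] d _) _ = N , ℚ.toℚᵘ-cancel-≤ (begin
      ℚ.toℚᵘ (σ ℚ.* (+ 1 ℚ./ suc N))
        ≃⟨ ℚ.toℚᵘ-homo-* σ (+ 1 ℚ./ suc N) ⟩
      ℚ.toℚᵘ σ ℚᵘ.* ℚ.toℚᵘ (+ 1 ℚ./ suc N)
        ≃⟨ ℚᵘ.*-cong (ℚ.toℚᵘ-fromℚᵘ (+ suc p ℚᵘ./ 1)) (ℚ.toℚᵘ-fromℚᵘ (+ 1 ℚᵘ./ suc N)) ⟩
      (+ suc p ℚᵘ./ 1) ℚᵘ.* (+ 1 ℚᵘ./ suc N)
        ≤⟨ ℚᵘ.*≤* (ℤ.+≤+ bound) ⟩
      ℚ.toℚᵘ ε ∎)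
      where
      open ℚᵘ.≤-Reasoning
      N = suc p ℕ.* suc d
      bound : suc p ℕ.* 1 ℕ.* suc d ℕ.≤ suc a ℕ.* (1 ℕ.* suc N)
      bound = ℕ.≤-trans
        (ℕ.≤-reflexive (cong (ℕ._* suc d) (ℕ.*-identityʳ (suc p))))
        (ℕ.≤-trans (ℕ.n≤1+n N)
          (ℕ.≤-trans (ℕ.≤-reflexive (sym (ℕ.*-identityˡ (suc N))))
            (ℕ.m≤n*m (1 ℕ.* suc N) (suc a))))

    isCauchy : IsCauchy S
    isCauchy ε 0<ε =
      let N , σ/N≤ε = archimedean ε 0<ε
      in N , λ m n N≤m N≤n → ℚ.≤-trans (∣difference∣≤ N m n N≤m N≤n)
        (ℚ.≤-trans (ℚ.*-monoˡ-≤-nonNeg σ (t≤1/ N)) σ/N≤ε)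

-- log zero is a junk value.

log : ℕ → ℝ
log zero    = fromℚ 0ℚ
log (suc p) = mkℝ (logPartialSum p) (LogCauchy.isCauchy p)

{-# OPTIONS --safe #-}

-- Upper bound.  Take N = 2ᴶ vertices, 4rs < N ≤ 8rs.  If a colouring has no red P_r and no blue P_s, the lengths
-- a(v) < r and b(v) < s of the longest red and blue walks leaving v have no clash, i.e. no edge u < v with
-- a(u) = a(v) and b(u) ≤ b(v).  Weight the pair u < v separated at scale 2ʲ of the dyadic tree by 2⁻ʲ.  A
-- recursion over the tree shows that every labelling in [r] × [s] has clashes of weight at least a 1/(2rJ²)
-- fraction of the total weight, so a greedily chosen set of 2rJ² log₂ (rs)ᴺ ≤ 2rJ³N = O(r² s (log s)³) pairs
-- meets the clashes of all (rs)ᴺ labellings.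
--
-- Lower bound.  A graph is not forcing as soon as its vertices have labels (a, b) in [r] × [s] such that a or b
-- increases along every edge.  With fewer than r² s / 8 edges, deleting rs/4 vertices leaves all degrees below
-- r/2; the deleted vertices get distinct labels, increasing lexicographically, and the others a proper colouring
-- by r/2 pairwise incomparable labels that are also incomparable with the former.
--
-- The minimum exists constructively because arrowing is decidable and m edges need only 2m vertices.

module Submission where

open import Defs
open import Data.Nat.Base using (ℕ; _≤_; _*_; _^_)
open import Data.Integer.Base using (+_)
open import Data.Rational.Base using (_/_)
open import Data.Product.Base using (Σ; ∃; _×_)

import Algebra.Properties.CommutativeSemigroup as CommutativeSemigroupProperties
open import Data.Bool.Base using (if_then_else_)
open import Data.Empty using (⊥)
open import Data.Fin.Base as Fin using (Fin; zero; suc; toℕ; fromℕ<; opposite; combine; remQuot;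
  finToFun; funToFin; _↑ˡ_; _↑ʳ_)
import Data.Fin.Properties as Fin
import Data.Integer.Base as ℤ
import Data.Integer.Properties as ℤ
open import Data.List.Base using (List; []; _∷_; _++_; map; length; filter; cartesianProduct;
  allFin; tabulate; lookup; deduplicate)
open import Data.List.Membership.Propositional using (_∈_; _∉_; find)
open import Data.List.Membership.Propositional.Properties using (∈-allFin; ∈-deduplicate⁺;
  ∈-++⁺ˡ; ∈-++⁺ʳ; ∈-filter⁺; ∈-lookup; ∈-map⁺; ∈-map⁻)
open import Data.List.Properties using (length-++; length-deduplicate; length-map; length-tabulate)
open import Data.List.Relation.Unary.All as All using (All; []; _∷_)
import Data.List.Relation.Unary.All.Properties as All
open import Data.List.Relation.Unary.AllPairs using (_∷_)
open import Data.List.Relation.Unary.Any as Any using (Any; here; there; index)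
open import Data.List.Relation.Unary.Any.Properties using (lookup-index)
import Data.List.Relation.Unary.Unique.DecPropositional.Properties as UniqueDec
open import Data.List.Relation.Unary.Unique.Propositional using (Unique)
open import Data.Nat.Base as ℕ using (zero; suc; pred; _+_; _<_; z≤n; s≤s; s≤s⁻¹; _≤′_; ≤′-refl; ≤′-step;
  NonZero; >-nonZero⁻¹)
open import Data.Nat.DivMod using (_%_; m%n<n; m≡m%n+[m/n]*n; m<n*o⇒m/o<n; /-monoˡ-≤)
open import Data.Nat.Properties
open import Data.Nat.Tactic.RingSolver using (solve-∀)
open import Data.Product.Base using (_,_; proj₁; proj₂)
open import Data.Product.Properties using (≡-dec)
open import Data.Rational.Base as ℚ using (ℚ; 0ℚ; 1ℚ)
import Data.Rational.Properties as ℚ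
import Data.Rational.Unnormalised.Base as ℚᵘ
import Data.Rational.Unnormalised.Properties as ℚᵘ
open import Data.Sum.Base as Sum using (_⊎_; inj₁; inj₂; [_,_])
open import Data.Unit.Base using (⊤; tt)
open import Data.Vec.Base as Vec using (Vec; []; _∷_)
open import Data.Vec.Functional using (updateAt)
open import Data.Vec.Functional.Properties using (updateAt-updates; updateAt-minimal)
open import Data.Vec.Properties using (lookup∘tabulate)
open import Function.Base using (_∘_; id; const)
open import Relation.Binary.Definitions using (tri<; tri≈; tri>)
open import Relation.Binary.PropositionalEquality using (_≡_; _≢_; refl; sym; trans; cong; cong₂;
  subst; subst₂; setoid; module ≡-Reasoning)
open import Relation.Nullary using (Dec; yes; no; does; ¬_; ¬?; contradiction; _×-dec_; _⊎-dec_; _→-dec_)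
open import Relation.Nullary.Decidable using (map′; decidable-stable)

open CommutativeSemigroupProperties *-commutativeSemigroup using (x∙yz≈y∙xz) renaming (interchange to *-interchange)
open CommutativeSemigroupProperties +-commutativeSemigroup using () renaming (interchange to +-interchange)

-- Finite sums

⟦_⟧ : {P : Set} → Dec P → ℕ
⟦ P? ⟧ = if does P? then 1 else 0

⟦⟧-mono : {P Q : Set} (P? : Dec P) (Q? : Dec Q) → (P → Q) → ⟦ P? ⟧ ≤ ⟦ Q? ⟧
⟦⟧-mono (no _)  _       _   = z≤n
⟦⟧-mono (yes _) (yes _) _   = ≤-refl
⟦⟧-mono (yes p) (no ¬q) P⇒Q = contradiction (P⇒Q p) ¬q

⟦⟧≤1 : {P : Set} (P? : Dec P) → ⟦ P? ⟧ ≤ 1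
⟦⟧≤1 (yes _) = ≤-refl
⟦⟧≤1 (no _)  = z≤n

⟦⟧-× : {P Q R : Set} (P? : Dec P) (Q? : Dec Q) (R? : Dec R) → (P → Q → R) → ⟦ P? ⟧ * ⟦ Q? ⟧ ≤ ⟦ R? ⟧
⟦⟧-× (no _)  _       _       _ = z≤n
⟦⟧-× (yes _) (no _)  _       _ = z≤n
⟦⟧-× (yes _) (yes _) (yes _) _ = ≤-refl
⟦⟧-× (yes p) (yes q) (no ¬r) f = contradiction (f p q) ¬r

⟦⟧-⊎ : {P Q R : Set} (P? : Dec P) (Q? : Dec Q) (R? : Dec R) → (P → Q ⊎ R) → ⟦ P? ⟧ ≤ ⟦ Q? ⟧ + ⟦ R? ⟧
⟦⟧-⊎ (no _)  _       _       _ = z≤n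
⟦⟧-⊎ (yes _) (yes _) _       _ = s≤s z≤n
⟦⟧-⊎ (yes _) (no _)  (yes _) _ = ≤-refl
⟦⟧-⊎ (yes p) (no ¬q) (no ¬r) f with f p
... | inj₁ q = contradiction q ¬q
... | inj₂ r = contradiction r ¬r

⟦⟧-yes : {P : Set} (P? : Dec P) → P → ⟦ P? ⟧ ≡ 1
⟦⟧-yes (yes _) _ = refl
⟦⟧-yes (no ¬p) p = contradiction p ¬p

⟦⟧-no : {P : Set} (P? : Dec P) → ¬ P → ⟦ P? ⟧ ≡ 0
⟦⟧-no (yes p) ¬p = contradiction p ¬p
⟦⟧-no (no _)  _  = refl

module _ {A : Set} where

  ∑ : List A → (A → ℕ) → ℕ
  ∑ []       f = 0
  ∑ (x ∷ xs) f = f x + ∑ xs f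

  ∑-mono : ∀ xs {f g : A → ℕ} → (∀ x → f x ≤ g x) → ∑ xs f ≤ ∑ xs g
  ∑-mono []       f≤g = z≤n
  ∑-mono (x ∷ xs) f≤g = +-mono-≤ (f≤g x) (∑-mono xs f≤g)

  ∑-mono-< : ∀ {f g : A → ℕ} {x xs} → (∀ x → f x ≤ g x) → x ∈ xs → f x < g x → ∑ xs f < ∑ xs g
  ∑-mono-< f≤g (here {xs = xs} refl) fx<gx = +-mono-<-≤ fx<gx (∑-mono xs f≤g)
  ∑-mono-< f≤g (there {x = x} x∈)    fx<gx = +-mono-≤-< (f≤g x) (∑-mono-< f≤g x∈ fx<gx)

  ∈⇒≤∑ : ∀ {f : A → ℕ} {x xs} → x ∈ xs → f x ≤ ∑ xs f
  ∈⇒≤∑         (here refl)       = m≤m+n _ _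
  ∈⇒≤∑ {f = f} (there {y} x∈xs) = ≤-trans (∈⇒≤∑ x∈xs) (m≤n+m _ (f y))

  ∑-cong : ∀ xs {f g : A → ℕ} → (∀ x → f x ≡ g x) → ∑ xs f ≡ ∑ xs g
  ∑-cong []       f≡g = refl
  ∑-cong (x ∷ xs) f≡g = cong₂ _+_ (f≡g x) (∑-cong xs f≡g)

  ∑-++ : ∀ xs ys {f} → ∑ (xs ++ ys) f ≡ ∑ xs f + ∑ ys f
  ∑-++ []       ys     = refl
  ∑-++ (x ∷ xs) ys {f} = trans (cong (f x ℕ.+_) (∑-++ xs ys)) (sym (+-assoc (f x) _ _))

  ∑-+ : ∀ xs (f g : A → ℕ) → ∑ xs (λ x → f x + g x) ≡ ∑ xs f + ∑ xs g
  ∑-+ []       f g = refl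
  ∑-+ (x ∷ xs) f g = trans (cong (f x + g x ℕ.+_) (∑-+ xs f g)) (+-interchange (f x) (g x) _ _)

  ∑-*ˡ : ∀ xs c (f : A → ℕ) → ∑ xs (λ x → c * f x) ≡ c * ∑ xs f
  ∑-*ˡ []       c f = sym (*-zeroʳ c)
  ∑-*ˡ (x ∷ xs) c f = trans (cong (c * f x ℕ.+_) (∑-*ˡ xs c f)) (sym (*-distribˡ-+ c (f x) _))

  ∑-const : ∀ xs c → ∑ xs (λ _ → c) ≡ length xs * c
  ∑-const []       c = refl
  ∑-const (_ ∷ xs) c = cong (c ℕ.+_) (∑-const xs c)

  ∑<length* : ∀ {k} {f : A → ℕ} xs → 0 < length xs → All (λ x → f x < k) xs → ∑ xs f < length xs * k
  ∑<length* (x ∷ [])         _ (fx<k ∷ []) = +-monoˡ-< 0 fx<k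
  ∑<length* (x ∷ xs@(_ ∷ _)) _ (fx<k ∷ f<k) = +-mono-< fx<k (∑<length* xs (s≤s z≤n) f<k)

  length-filter≡∑ : ∀ {P : A → Set} (P? : ∀ x → Dec (P x)) xs → length (filter P? xs) ≡ ∑ xs (λ x → ⟦ P? x ⟧)
  length-filter≡∑ P? []       = refl
  length-filter≡∑ P? (x ∷ xs) with P? x
  ... | yes _ = cong suc (length-filter≡∑ P? xs)
  ... | no  _ = length-filter≡∑ P? xs

  ∑-filter : ∀ {P : A → Set} (P? : ∀ x → Dec (P x)) xs →
             length (filter (λ x → ¬? (P? x)) xs) + ∑ xs (λ x → ⟦ P? x ⟧) ≡ length xs
  ∑-filter P? []       = refl
  ∑-filter P? (x ∷ xs) with P? x
  ... | yes _ = trans (+-suc _ _) (cong suc (∑-filter P? xs))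
  ... | no  _ = cong suc (∑-filter P? xs)

∑-map : {A B : Set} (g : B → A) → ∀ xs {f} → ∑ (map g xs) f ≡ ∑ xs (f ∘ g)
∑-map g []           = refl
∑-map g (x ∷ xs) {f} = cong (f (g x) ℕ.+_) (∑-map g xs)

module _ {A B : Set} where

  ∑-swap : ∀ (xs : List A) (ys : List B) (f : A → B → ℕ) →
           ∑ xs (λ x → ∑ ys (f x)) ≡ ∑ ys (λ y → ∑ xs (λ x → f x y))
  ∑-swap []       ys f = sym (trans (∑-const ys 0) (*-zeroʳ (length ys)))
  ∑-swap (x ∷ xs) ys f = trans (cong (∑ ys (f x) ℕ.+_) (∑-swap xs ys f)) (sym (∑-+ ys (f x) _))

  ∑-cartesianProduct : ∀ (xs : List A) (ys : List B) {f : A × B → ℕ} →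
    ∑ (cartesianProduct xs ys) f ≡ ∑ xs (λ x → ∑ ys (λ y → f (x , y)))
  ∑-cartesianProduct []       ys     = refl
  ∑-cartesianProduct (x ∷ xs) ys {f} = trans (∑-++ (map (x ,_) ys) _)
    (cong₂ _+_ (∑-map (x ,_) ys) (∑-cartesianProduct xs ys))

  ∑-*-∑ : ∀ (xs : List A) (ys : List B) (f : A → ℕ) (g : B → ℕ) →
          ∑ xs f * ∑ ys g ≡ ∑ xs (λ x → ∑ ys (λ y → f x * g y))
  ∑-*-∑ []       ys f g = refl
  ∑-*-∑ (x ∷ xs) ys f g = trans (*-distribʳ-+ (∑ ys g) (f x) _)
    (cong₂ _+_ (sym (∑-*ˡ ys (f x) g)) (∑-*-∑ xs ys f g))

-- Greedy hitting sets

-- (n + p) pⁿ ≤ p (1 + p)ⁿ is Bernoulli's inequality multiplied by p.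
bernoulli : ∀ p n → (n + p) * p ^ n ≤ p * suc p ^ n
bernoulli p zero    = ≤-refl
bernoulli p (suc n) = begin
  (suc n + p) * (p * p ^ n)            ≡⟨ left n p (p ^ n) ⟩
  (p * n + p + p * p) * p ^ n          ≤⟨ *-monoˡ-≤ (p ^ n) (m≤n+m _ n) ⟩
  (n + (p * n + p + p * p)) * p ^ n    ≡⟨ right n p (p ^ n) ⟩
  suc p * ((n + p) * p ^ n)            ≤⟨ *-monoʳ-≤ (suc p) (bernoulli p n) ⟩
  suc p * (p * suc p ^ n)              ≡⟨ x∙yz≈y∙xz (suc p) p (suc p ^ n) ⟩
  p * (suc p * suc p ^ n)              ∎
  where
  open ≤-Reasoning
  left : ∀ n p x → (suc n + p) * (p * x) ≡ (p * n + p + p * p) * x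
  left = solve-∀
  right : ∀ n p x → (n + (p * n + p + p * p)) * x ≡ suc p * ((n + p) * x)
  right = solve-∀

-- For p > 0 this says that (1 + 1/p)^(p + 1) ≥ 2, which follows from Bernoulli's inequality. Hence
-- p + 1 greedy steps, each shrinking by the factor p/(p + 1), at least halve the unhit part.
2*p^≤suc-p^ : ∀ p → 2 * p ^ suc p ≤ suc p ^ suc p
2*p^≤suc-p^ zero      = z≤n
2*p^≤suc-p^ p@(suc _) = *-cancelˡ-≤ p (begin
  p * (2 * p ^ suc p)         ≡⟨ double p (p ^ suc p) ⟩
  (p + p) * p ^ suc p         ≤⟨ *-monoˡ-≤ (p ^ suc p) (n≤1+n (p + p)) ⟩
  (suc p + p) * p ^ suc p     ≤⟨ bernoulli p (suc p) ⟩
  p * suc p ^ suc p           ∎)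
  where
  open ≤-Reasoning
  double : ∀ p x → p * (2 * x) ≡ (p + p) * x
  double = solve-∀

^-distribʳ-* : ∀ m n k → (m * n) ^ k ≡ m ^ k * n ^ k
^-distribʳ-* m n zero    = refl
^-distribʳ-* m n (suc k) = trans (cong (m * n *_) (^-distribʳ-* m n k)) (*-interchange m n (m ^ k) (n ^ k))

-- The density is written 1/(p + 1), so that the shrinking factor p/(p + 1) needs no subtraction.
-- `E` may have repetitions, and its multiplicities act as weights.
module HittingSet {A B : Set} {R : A → B → Set} (R? : ∀ a b → Dec (R a b))
                  (E : List B) (0<∣E∣ : 0 < length E) (p : ℕ)
                  (dense : ∀ a → length E ≤ suc p * ∑ E (λ e → ⟦ R? a e ⟧)) where

  private
    q = suc p

    degree : List A → B → ℕ
    degree F e = ∑ F (λ a → ⟦ R? a e ⟧)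

  -- Double counting: by `dense`, the average of `q * degree F e` over `E` is at least `length F`,
  -- so some entry reaches the average.
  popular : ∀ F → ∃ λ e → e ∈ E × length F ≤ q * degree F e
  popular F with Any.any? (λ e → length F ≤? q * degree F e) E
  ... | yes any = find any
  ... | no ¬any = contradiction (≤-<-trans many few) (<-irrefl (*-comm (length F) (length E)))
    where
    few : ∑ E (λ e → q * degree F e) < length E * length F
    few = ∑<length* E 0<∣E∣ (All.map ≰⇒> (All.¬Any⇒All¬ E ¬any))
    open ≤-Reasoning
    many : length F * length E ≤ ∑ E (λ e → q * degree F e)
    many = begin
      length F * length E                            ≡⟨ ∑-const F (length E) ⟨
      ∑ F (λ _ → length E)                           ≤⟨ ∑-mono F dense ⟩
      ∑ F (λ a → q * ∑ E (λ e → ⟦ R? a e ⟧))         ≡⟨ ∑-*ˡ F q _ ⟩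
      q * ∑ F (λ a → ∑ E (λ e → ⟦ R? a e ⟧))         ≡⟨ cong (q *_) (∑-swap F E _) ⟩
      q * ∑ E (degree F)                             ≡⟨ ∑-*ˡ E q _ ⟨
      ∑ E (λ e → q * degree F e)                     ∎

  record PartialCover (j : ℕ) (F : List A) : Set where
    field
      chosen   : List B
      chosen⊆E : All (_∈ E) chosen
      size     : length chosen ≤ j
      missed   : List A
      covers   : ∀ {a} → a ∈ F → a ∈ missed ⊎ Any (R a) chosen
      -- The bound (p/q)^j on the missed fraction, cleared of denominators.
      shrinks  : length missed * q ^ j ≤ p ^ j * length F

  greedy : ∀ j F → PartialCover j F
  greedy zero    F = record
    { chosen = [] ; chosen⊆E = [] ; size = z≤n ; missed = F ; covers = inj₁
    ; shrinks = ≤-reflexive (trans (*-identityʳ (length F)) (sym (*-identityˡ (length F)))) }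
  greedy (suc j) F = record
    { chosen = e ∷ chosen ; chosen⊆E = e∈E ∷ chosen⊆E ; size = s≤s size ; missed = missed
    ; covers = covers′ ; shrinks = shrinks′ }
    where
    e = proj₁ (popular F)
    e∈E = proj₁ (proj₂ (popular F))
    F₁ = filter (λ a → ¬? (R? a e)) F
    open PartialCover (greedy j F₁)
    covers′ : ∀ {a} → a ∈ F → a ∈ missed ⊎ Any (R a) (e ∷ chosen)
    covers′ {a} a∈F with R? a e
    ... | yes r = inj₂ (here r)
    ... | no ¬r with covers (∈-filter⁺ (λ a → ¬? (R? a e)) a∈F ¬r)
    ...   | inj₁ a∈missed = inj₁ a∈missed
    ...   | inj₂ hit      = inj₂ (there hit)
    open ≤-Reasoning
    -- Since e is popular, at most |F| - |F|/q members remain; adding `length F` on both sides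
    -- avoids the subtraction.
    first : q * length F₁ ≤ p * length F
    first = +-cancelʳ-≤ (length F) _ _ (begin
      q * length F₁ + length F          ≤⟨ +-monoʳ-≤ (q * length F₁) (proj₂ (proj₂ (popular F))) ⟩
      q * length F₁ + q * degree F e    ≡⟨ *-distribˡ-+ q (length F₁) _ ⟨
      q * (length F₁ + degree F e)      ≡⟨ cong (q *_) (∑-filter (λ a → R? a e) F) ⟩
      q * length F                      ≡⟨ +-comm (length F) (p * length F) ⟩
      p * length F + length F           ∎)
    shrinks′ : length missed * q ^ suc j ≤ p ^ suc j * length F
    shrinks′ = begin
      length missed * (q * q ^ j)    ≡⟨ x∙yz≈y∙xz (length missed) q (q ^ j) ⟩
      q * (length missed * q ^ j)    ≤⟨ *-monoʳ-≤ q shrinks ⟩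
      q * (p ^ j * length F₁)        ≡⟨ x∙yz≈y∙xz q (p ^ j) (length F₁) ⟩
      p ^ j * (q * length F₁)        ≤⟨ *-monoʳ-≤ (p ^ j) first ⟩
      p ^ j * (p * length F)         ≡⟨ x∙yz≈y∙xz (p ^ j) p (length F) ⟩
      p * (p ^ j * length F)         ≡⟨ *-assoc p (p ^ j) (length F) ⟨
      p * p ^ j * length F           ∎

  -- Each block of q greedy steps halves the missed part, so after `q * h` steps fewer than |F| /
  -- 2^h + 1 members can be missed; as |F| < 2^h, none is.
  hittingSet : ∀ F h → length F < 2 ^ h →
    ∃ λ S → length S ≤ q * h × All (_∈ E) S × (∀ {a} → a ∈ F → Any (R a) S)
  hittingSet F h ∣F∣<2^h = chosen , size , chosen⊆E , all
    where
    open PartialCover (greedy (q * h) F)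
    open ≤-Reasoning
    halved : 2 ^ h * p ^ (q * h) ≤ q ^ (q * h)
    halved = begin
      2 ^ h * p ^ (q * h)    ≡⟨ cong (2 ^ h *_) (^-*-assoc p q h) ⟨
      2 ^ h * (p ^ q) ^ h    ≡⟨ ^-distribʳ-* 2 (p ^ q) h ⟨
      (2 * p ^ q) ^ h        ≤⟨ ^-monoˡ-≤ h (2*p^≤suc-p^ p) ⟩
      (q ^ q) ^ h            ≡⟨ ^-*-assoc q q h ⟩
      q ^ (q * h)            ∎
    small : length missed * 2 ^ h ≤ length F
    small = *-cancelˡ-≤ (q ^ (q * h)) {{m^n≢0 q (q * h)}} (begin
      q ^ (q * h) * (length missed * 2 ^ h)    ≡⟨ rotate (q ^ (q * h)) (length missed) (2 ^ h) ⟩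
      2 ^ h * (length missed * q ^ (q * h))    ≤⟨ *-monoʳ-≤ (2 ^ h) shrinks ⟩
      2 ^ h * (p ^ (q * h) * length F)         ≡⟨ *-assoc (2 ^ h) (p ^ (q * h)) (length F) ⟨
      2 ^ h * p ^ (q * h) * length F           ≤⟨ *-monoˡ-≤ (length F) halved ⟩
      q ^ (q * h) * length F                   ∎)
      where
      rotate : ∀ a b c → a * (b * c) ≡ c * (b * a)
      rotate = solve-∀
    all : ∀ {a} → a ∈ F → Any (R a) chosen
    all a∈F with covers a∈F
    ... | inj₂ hit = hit
    ... | inj₁ a∈missed with missed | small
    -- A nonempty `missed` would force 2^h ≤ |F|.
    ...   | _ ∷ ms | small′ = contradiction (<-≤-trans ∣F∣<2^h (m≤m+n (2 ^ h) (length ms * 2 ^ h))) (≤⇒≯ small′)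

-- Weighted pairs on a dyadic vertex set

∑-tabulate-+ : ∀ m {n} {A : Set} (g : Fin (m + n) → A) {f} →
  ∑ (tabulate g) f ≡ ∑ (tabulate (g ∘ (_↑ˡ n))) f + ∑ (tabulate (g ∘ (m ↑ʳ_))) f
∑-tabulate-+ zero    g     = refl
∑-tabulate-+ (suc m) g {f} = trans (cong (f (g zero) ℕ.+_) (∑-tabulate-+ m (g ∘ suc)))
  (sym (+-assoc (f (g zero)) _ _))

∑-tabulate : ∀ {n} {A : Set} (g : Fin n → A) (f : A → ℕ) → ∑ (tabulate g) f ≡ ∑ (allFin n) (f ∘ g)
∑-tabulate {zero}  g f = refl
∑-tabulate {suc n} g f = cong (f (g zero) ℕ.+_)
  (trans (∑-tabulate (g ∘ suc) f) (sym (∑-tabulate {A = Fin (suc n)} suc (f ∘ g))))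

∑-allFin-+ : ∀ m n f →
  ∑ (allFin (m + n)) f ≡ ∑ (allFin m) (f ∘ (_↑ˡ n)) + ∑ (allFin n) (f ∘ (m ↑ʳ_))
∑-allFin-+ m n f = trans (∑-tabulate-+ m id) (cong₂ _+_ (∑-tabulate (_↑ˡ n) f) (∑-tabulate (m ↑ʳ_) f))

2*m*n≤m*m+n*n : ∀ m n → 2 * m * n ≤ m * m + n * n
2*m*n≤m*m+n*n m n with ≤-total m n
... | inj₁ m≤n with m≤n⇒∃[o]m+o≡n m≤n
...   | o , refl = subst (2 * m * (m + o) ≤_) (sym (expand m o)) (m≤m+n _ (o * o))
  where
  expand : ∀ m o → m * m + (m + o) * (m + o) ≡ 2 * m * (m + o) + o * o
  expand = solve-∀
2*m*n≤m*m+n*n m n | inj₂ n≤m with m≤n⇒∃[o]m+o≡n n≤m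
...   | o , refl = subst (2 * (n + o) * n ≤_) (sym (expand n o)) (m≤m+n _ (o * o))
  where
  expand : ∀ m o → (m + o) * (m + o) + m * m ≡ 2 * (m + o) * m + o * o
  expand = solve-∀

-- Defined by doubling instead of as `2 ^ J`, so that the vertex set splits definitionally into a
-- left and a right half.
size : ℕ → ℕ
size zero    = 1
size (suc J) = size J + size J

size≡2^ : ∀ J → size J ≡ 2 ^ J
size≡2^ zero    = refl
size≡2^ (suc J) = cong₂ _+_ (size≡2^ J) (trans (size≡2^ J) (sym (+-identityʳ (2 ^ J))))

Pair : ℕ → Set
Pair n = Fin n × Fin n

lefts rights : ∀ {n} → Pair n → Pair (n + n)
lefts  {n} (u , v) = u ↑ˡ n , v ↑ˡ n
rights {n} (u , v) = n ↑ʳ u , n ↑ʳ v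

-- A pair separated at scale 2ʲ occurs with multiplicity 2^(J - 1 - j), so that every scale contributes
-- the same total weight.
pairs : ∀ J → List (Pair (size J))
pairs zero    = []
pairs (suc J) = map lefts (pairs J) ++ map lefts (pairs J) ++ map rights (pairs J) ++ map rights (pairs J) ++
  cartesianProduct (map (_↑ˡ n) (allFin n)) (map (n ↑ʳ_) (allFin n))
  where n = size J

pairs-ordered : ∀ J → All (λ (u , v) → u Fin.< v) (pairs J)
pairs-ordered zero    = []
pairs-ordered (suc J) =
  All.++⁺ inLeft (All.++⁺ inLeft (All.++⁺ inRight (All.++⁺ inRight
    (All.cartesianProduct⁺ (setoid _) (setoid _) _ _ across))))
  where
  n = size J
  inLeft : All (λ (u , v) → u Fin.< v) (map lefts (pairs J))
  inLeft = All.map⁺ (All.map (λ {(u , v)} →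
    subst₂ _<_ (sym (Fin.toℕ-↑ˡ u n)) (sym (Fin.toℕ-↑ˡ v n))) (pairs-ordered J))
  inRight : All (λ (u , v) → u Fin.< v) (map rights (pairs J))
  inRight = All.map⁺ (All.map (λ {(u , v)} u<v →
    subst₂ _<_ (sym (Fin.toℕ-↑ʳ n u)) (sym (Fin.toℕ-↑ʳ n v)) (+-monoʳ-< n u<v)) (pairs-ordered J))
  across : ∀ {u v} → u ∈ map (_↑ˡ n) (allFin n) → v ∈ map (n ↑ʳ_) (allFin n) → u Fin.< v
  across u∈ v∈ with ∈-map⁻ (_↑ˡ n) u∈ | ∈-map⁻ (n ↑ʳ_) v∈
  ... | x , _ , refl | y , _ , refl =
    subst₂ _<_ (sym (Fin.toℕ-↑ˡ x n)) (sym (Fin.toℕ-↑ʳ n y)) (<-≤-trans (Fin.toℕ<n x) (m≤m+n n (toℕ y)))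

∑-pairs : ∀ J {f} → ∑ (pairs (suc J)) f ≡
  2 * ∑ (pairs J) (f ∘ lefts) + 2 * ∑ (pairs J) (f ∘ rights) +
  ∑ (allFin (size J)) (λ u → ∑ (allFin (size J)) (λ v → f (u ↑ˡ size J , size J ↑ʳ v)))
∑-pairs J {f} = begin
  ∑ (L ++ L ++ R ++ R ++ X) f
    ≡⟨ trans (∑-++ L _) (cong (∑ L f ℕ.+_) (trans (∑-++ L _) (cong (∑ L f ℕ.+_)
         (trans (∑-++ R _) (cong (∑ R f ℕ.+_) (∑-++ R _)))))) ⟩
  ∑ L f + (∑ L f + (∑ R f + (∑ R f + ∑ X f)))
    ≡⟨ collect (∑ L f) (∑ R f) (∑ X f) ⟩
  2 * ∑ L f + 2 * ∑ R f + ∑ X f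
    ≡⟨ cong₂ _+_ (cong₂ (λ x y → 2 * x + 2 * y) (∑-map lefts (pairs J)) (∑-map rights (pairs J)))
         (trans (∑-cartesianProduct (map (_↑ˡ n) (allFin n)) _)
           (trans (∑-map (_↑ˡ n) (allFin n)) (∑-cong (allFin n) λ u → ∑-map (n ↑ʳ_) (allFin n)))) ⟩
  _ ∎
  where
  open ≡-Reasoning
  n = size J
  L = map lefts (pairs J)
  R = map rights (pairs J)
  X = cartesianProduct (map (_↑ˡ n) (allFin n)) (map (n ↑ʳ_) (allFin n))
  collect : ∀ l r x → l + (l + (r + (r + x))) ≡ 2 * l + 2 * r + x
  collect = solve-∀

-- Each of the J scales has total weight (size J)² / 4. Two copies of both halves multiply the old
-- weight by 4, just as doubling the size multiplies its square by 4, and the crossing pairs form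
-- the new scale.
length-pairs : ∀ J → 4 * length (pairs J) ≡ J * (size J * size J)
length-pairs zero    = refl
length-pairs (suc J) = begin
  4 * length (pairs (suc J))
    ≡⟨ cong (4 *_) (trans (sym (ones (pairs (suc J)))) (∑-pairs J)) ⟩
  4 * (2 * ∑ (pairs J) (λ _ → 1) + 2 * ∑ (pairs J) (λ _ → 1) + ∑ (allFin n) (λ _ → ∑ (allFin n) (λ _ → 1)))
    ≡⟨ cong₂ (λ x y → 4 * (2 * x + 2 * x + y)) (ones (pairs J))
         (trans (∑-const (allFin n) _) (cong₂ _*_ ∣allFin∣ (trans (ones (allFin n)) ∣allFin∣))) ⟩
  4 * (2 * length (pairs J) + 2 * length (pairs J) + n * n)
    ≡⟨ regroup (length (pairs J)) (n * n) ⟩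
  4 * (4 * length (pairs J) + n * n)
    ≡⟨ cong (λ x → 4 * (x + n * n)) (length-pairs J) ⟩
  4 * (J * (n * n) + n * n)
    ≡⟨ double J n ⟩
  suc J * ((n + n) * (n + n)) ∎
  where
  open ≡-Reasoning
  n = size J
  ∣allFin∣ : length (allFin n) ≡ n
  ∣allFin∣ = length-tabulate id
  ones : ∀ {A : Set} (xs : List A) → ∑ xs (λ _ → 1) ≡ length xs
  ones xs = trans (∑-const xs 1) (*-identityʳ (length xs))
  regroup : ∀ p m → 4 * (2 * p + 2 * p + m) ≡ 4 * (4 * p + m)
  regroup = solve-∀
  double : ∀ J n → 4 * (J * (n * n) + n * n) ≡ suc J * ((n + n) * (n + n))
  double = solve-∀

-- Moving the cut γ upwards, stop the first time x exceeds y; t is the smaller of the two values there.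
crossing : ∀ (x y : ℕ → ℕ) V → (∀ γ → x (suc γ) * y γ ≤ V) → ∀ d β → y (β + d) ≡ 0 → x β ≤ y β →
  ∃ λ γ → β ≤ γ × γ ≤ β + d × ∃ λ t → x γ + y γ ≤ 2 * t × t * t ≤ V
crossing x y V xy≤V zero β y≡0 x≤y =
  β , ≤-refl , m≤m+n β 0 , 0 , ≤-reflexive (cong₂ _+_ (n≤0⇒n≡0 (subst (x β ≤_) yβ≡0 x≤y)) yβ≡0) , z≤n
  where
  yβ≡0 : y β ≡ 0
  yβ≡0 = trans (cong y (sym (+-identityʳ β))) y≡0
crossing x y V xy≤V (suc d) β y≡0 x≤y with x (suc β) ≤? y (suc β)
... | yes x≤y′ with crossing x y V xy≤V d (suc β) (trans (cong y (sym (+-suc β d))) y≡0) x≤y′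
...   | γ , β<γ , γ≤ , rest = γ , <⇒≤ β<γ , subst (γ ≤_) (sym (+-suc β d)) γ≤ , rest
crossing x y V xy≤V (suc d) β y≡0 x≤y | no x≰y′ with x (suc β) ≤? y β
-- Here x first exceeds y at suc β. If x (suc β) ≤ y β, the cut is suc β and t = x (suc β), which
-- bounds y (suc β); otherwise the cut is β and t = y β, which bounds x β. In both cases t² ≤ x (suc
-- β) y β ≤ V.
... | yes x′≤y = suc β , n≤1+n β , m<m+n β (s≤s z≤n) , x (suc β) ,
  ≤-trans (+-monoʳ-≤ (x (suc β)) (<⇒≤ (≰⇒> x≰y′))) (≤-reflexive (cong (x (suc β) ℕ.+_) (sym (+-identityʳ _)))) ,
  ≤-trans (*-monoʳ-≤ (x (suc β)) x′≤y) (xy≤V β)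
... | no x′≰y = β , ≤-refl , m≤m+n β (suc d) , y β ,
  ≤-trans (+-monoˡ-≤ (y β) x≤y) (≤-reflexive (cong (y β ℕ.+_) (sym (+-identityʳ _)))) ,
  ≤-trans (*-monoˡ-≤ (y β) (<⇒≤ (≰⇒> x′≰y))) (xy≤V β)

-- Clashes within one class of the first label.

InClass : ∀ {n} (a b : Fin n → ℕ) (i lo hi : ℕ) → Fin n → Set
InClass a b i lo hi v = a v ≡ i × lo ≤ b v × b v < hi

inClass? : ∀ {n} (a b : Fin n → ℕ) i lo hi v → Dec (InClass a b i lo hi v)
inClass? a b i lo hi v = a v ≟ i ×-dec lo ≤? b v ×-dec b v <? hi

ClashIn : ∀ {n} (a b : Fin n → ℕ) (i : ℕ) → Pair n → Set
ClashIn a b i (u , v) = a u ≡ i × a v ≡ i × b u ≤ b v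

clashIn? : ∀ {n} (a b : Fin n → ℕ) i e → Dec (ClashIn a b i e)
clashIn? a b i (u , v) = a u ≟ i ×-dec a v ≟ i ×-dec b u ≤? b v

count : ∀ {n} (a b : Fin n → ℕ) (i lo hi : ℕ) → ℕ
count {n} a b i lo hi = ∑ (allFin n) (λ v → ⟦ inClass? a b i lo hi v ⟧)

clashes : ∀ J (a b : Fin (size J) → ℕ) (i : ℕ) → ℕ
clashes J a b i = ∑ (pairs J) (λ e → ⟦ clashIn? a b i e ⟧)

count-empty : ∀ {n} (a b : Fin n → ℕ) i lo → count a b i lo lo ≡ 0
count-empty {n} a b i lo = trans (∑-cong (allFin n) λ v → ⟦⟧-no (inClass? a b i lo lo v)
    λ (_ , lo≤ , <lo) → <⇒≱ <lo lo≤)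
  (trans (∑-const (allFin n) 0) (*-zeroʳ (length (allFin n))))

count-split : ∀ {n} (a b : Fin n → ℕ) i lo γ hi → count a b i lo hi ≤ count a b i lo γ + count a b i γ hi
count-split {n} a b i lo γ hi = ≤-trans
  (∑-mono (allFin n) λ v → ⟦⟧-⊎ (inClass? a b i lo hi v) (inClass? a b i lo γ v) (inClass? a b i γ hi v) (split v))
  (≤-reflexive (∑-+ (allFin n) _ _))
  where
  split : ∀ v → InClass a b i lo hi v → InClass a b i lo γ v ⊎ InClass a b i γ hi v
  split v (av≡i , lo≤ , <hi) with b v <? γ
  ... | yes <γ = inj₁ (av≡i , lo≤ , <γ)
  ... | no  ≮γ = inj₂ (av≡i , ≮⇒≥ ≮γ , <hi)

-- At each node of the dyadic tree a cut γ is chosen; the left vertices with b ≥ γ and the right ones with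
-- b < γ are handled recursively, the remaining ones, at most 2t, are dropped at the price of t² clashes.
-- The quadratic (qt - 2n)² ≥ 0 converts t² into a linear quantity.
class-bound : ∀ q i J (a b : Fin (size J) → ℕ) lo hi → lo ≤ hi →
  q * size J * (count a b i lo hi + lo) ≤ q * size J * hi + q * q * clashes J a b i + J * (size J * size J)
class-bound q i zero a b lo hi lo≤hi = begin
  q * 1 * (count a b i lo hi + lo)        ≤⟨ *-monoʳ-≤ (q * 1) atMostOne ⟩
  q * 1 * hi                              ≤⟨ m≤m+n _ _ ⟩
  q * 1 * hi + q * q * 0                  ≤⟨ m≤m+n _ _ ⟩
  q * 1 * hi + q * q * 0 + 0              ∎
  where
  open ≤-Reasoning
  atMostOne : count a b i lo hi + lo ≤ hi
  atMostOne = cases (inClass? a b i lo hi zero)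
    where
    cases : (in? : Dec (InClass a b i lo hi zero)) → ⟦ in? ⟧ + 0 + lo ≤ hi
    cases (yes (_ , lo≤ , <hi)) = ≤-<-trans lo≤ <hi
    cases (no _)                = lo≤hi
class-bound q i (suc J) a b lo hi lo≤hi with m≤n⇒∃[o]m+o≡n lo≤hi
-- The recursive intervals [γ, hi) and [lo, γ) have widths adding up to hi - lo; the γ terms are put
-- on both sides and cancel.
... | d , refl = +-cancelʳ-≤ (q * (n + n) * γ) _ _ (begin
  q * (n + n) * (c + lo) + q * (n + n) * γ
    ≤⟨ +-monoˡ-≤ (q * (n + n) * γ) (*-monoʳ-≤ (q * (n + n)) (+-monoˡ-≤ lo c≤)) ⟩
  q * (n + n) * (c₁ + c₂ + 2 * t + lo) + q * (n + n) * γ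
    ≡⟨ arrange q n c₁ c₂ t lo γ ⟩
  2 * (q * n * (c₁ + γ)) + 2 * (q * n * (c₂ + lo)) + 2 * (q * t) * (2 * n)
    ≤⟨ +-mono-≤ (+-mono-≤ (*-monoʳ-≤ 2 (class-bound q i J aˡ bˡ γ hi γ≤hi))
                          (*-monoʳ-≤ 2 (class-bound q i J aʳ bʳ lo γ lo≤γ)))
         -- The square (2n)² is the contribution of the new level; the recursive errors J n²,
         -- counted four times, give the remaining J (2n)².
         (≤-trans (2*m*n≤m*m+n*n (q * t) (2 * n)) (+-monoˡ-≤ (2 * n * (2 * n)) qtqt≤)) ⟩
  2 * (q * n * hi + q * q * W₁ + J * (n * n)) + 2 * (q * n * γ + q * q * W₂ + J * (n * n)) +
  (q * q * V + 2 * n * (2 * n))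
    ≡⟨ collect q n hi W₁ W₂ J γ V ⟩
  q * (n + n) * hi + q * q * (2 * W₁ + 2 * W₂ + V) + suc J * ((n + n) * (n + n)) + q * (n + n) * γ
    ≡⟨ cong (λ w → q * (n + n) * hi + q * q * w + suc J * ((n + n) * (n + n)) + q * (n + n) * γ) (∑-pairs J) ⟨
  q * (n + n) * hi + q * q * clashes (suc J) a b i + suc J * ((n + n) * (n + n)) + q * (n + n) * γ ∎)
  where
  open ≤-Reasoning
  n = size J
  aˡ = a ∘ (_↑ˡ n)
  aʳ = a ∘ (n ↑ʳ_)
  bˡ = b ∘ (_↑ˡ n)
  bʳ = b ∘ (n ↑ʳ_)
  V = ∑ (allFin n) (λ u → ∑ (allFin n) (λ v → ⟦ clashIn? a b i (u ↑ˡ n , n ↑ʳ v) ⟧))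
  x y : ℕ → ℕ
  x γ = count aˡ bˡ i lo γ
  y γ = count aʳ bʳ i γ hi
  -- `x (suc γ)` counts the left vertices with b ≤ γ and `y γ` the right ones with b ≥ γ, so every
  -- such pair clashes. This is why the arguments are shifted by one.
  xy≤V : ∀ γ → x (suc γ) * y γ ≤ V
  xy≤V γ = ≤-trans (≤-reflexive (∑-*-∑ (allFin n) (allFin n) _ _))
    (∑-mono (allFin n) λ u → ∑-mono (allFin n) λ v →
      ⟦⟧-× (inClass? aˡ bˡ i lo (suc γ) u) (inClass? aʳ bʳ i γ hi v) (clashIn? a b i (u ↑ˡ n , n ↑ʳ v))
        λ (au≡i , _ , bu<1+γ) (av≡i , γ≤bv , _) → au≡i , av≡i , ≤-trans (s≤s⁻¹ bu<1+γ) γ≤bv)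
  -- The search starts at lo, where x vanishes, and ends at hi, where y vanishes.
  cut = crossing x y V xy≤V d lo (count-empty aʳ bʳ i hi)
          (subst (_≤ y lo) (sym (count-empty aˡ bˡ i lo)) z≤n)
  γ = proj₁ cut
  lo≤γ = proj₁ (proj₂ cut)
  γ≤hi = proj₁ (proj₂ (proj₂ cut))
  t = proj₁ (proj₂ (proj₂ (proj₂ cut)))
  x+y≤2t = proj₁ (proj₂ (proj₂ (proj₂ (proj₂ cut))))
  tt≤V = proj₂ (proj₂ (proj₂ (proj₂ (proj₂ cut))))
  c = count a b i lo hi
  c₁ = count aˡ bˡ i γ hi
  c₂ = count aʳ bʳ i lo γ
  W₁ = clashes J aˡ bˡ i
  W₂ = clashes J aʳ bʳ i
  c≤ : c ≤ c₁ + c₂ + 2 * t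
  c≤ = begin
    c                                                ≡⟨ ∑-allFin-+ n n _ ⟩
    count aˡ bˡ i lo hi + count aʳ bʳ i lo hi
      ≤⟨ +-mono-≤ (count-split aˡ bˡ i lo γ hi) (count-split aʳ bʳ i lo γ hi) ⟩
    (x γ + c₁) + (c₂ + y γ)                          ≡⟨ exchange (x γ) c₁ c₂ (y γ) ⟩
    c₁ + c₂ + (x γ + y γ)                            ≤⟨ +-monoʳ-≤ (c₁ + c₂) x+y≤2t ⟩
    c₁ + c₂ + 2 * t                                  ∎
    where
    exchange : ∀ x c d y → (x + c) + (d + y) ≡ c + d + (x + y)
    exchange = solve-∀
  qtqt≤ : q * t * (q * t) ≤ q * q * V
  qtqt≤ = ≤-trans (≤-reflexive (square q t)) (*-monoʳ-≤ (q * q) tt≤V)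
    where
    square : ∀ q t → q * t * (q * t) ≡ q * q * (t * t)
    square = solve-∀
  arrange : ∀ q n c d t lo γ → q * (n + n) * (c + d + 2 * t + lo) + q * (n + n) * γ ≡
    2 * (q * n * (c + γ)) + 2 * (q * n * (d + lo)) + 2 * (q * t) * (2 * n)
  arrange = solve-∀
  collect : ∀ q n hi W W′ J γ V →
    2 * (q * n * hi + q * q * W + J * (n * n)) + 2 * (q * n * γ + q * q * W′ + J * (n * n)) +
    (q * q * V + 2 * n * (2 * n)) ≡
    q * (n + n) * hi + q * q * (2 * W + 2 * W′ + V) + suc J * ((n + n) * (n + n)) + q * (n + n) * γ
  collect = solve-∀

-- Total clash weight of a bounded labelling.

∑-atMostOne : ∀ {n} {P : Fin n → Set} (P? : ∀ i → Dec (P i)) {Q : Set} (Q? : Dec Q) →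
  (∀ {i j} → P i → P j → i ≡ j) → (∀ {i} → P i → Q) → ∑ (allFin n) (λ i → ⟦ P? i ⟧) ≤ ⟦ Q? ⟧
∑-atMostOne {zero}  P? Q? unique P⇒Q = z≤n
∑-atMostOne {suc n} {P} P? Q? unique P⇒Q with P? zero
... | yes p₀ = ≤-reflexive (trans (cong suc (trans (∑-tabulate {A = Fin (suc n)} suc (λ i → ⟦ P? i ⟧)) (trans
    (∑-cong (allFin n) λ i → ⟦⟧-no (P? (suc i)) λ pᵢ → Fin.0≢1+n (unique p₀ pᵢ))
    (trans (∑-const (allFin n) 0) (*-zeroʳ (length (allFin n)))))))
  (sym (⟦⟧-yes Q? (P⇒Q p₀))))
... | no _ = ≤-trans (≤-reflexive (∑-tabulate {A = Fin (suc n)} suc (λ i → ⟦ P? i ⟧)))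
  (∑-atMostOne (P? ∘ suc) Q? (λ pᵢ pⱼ → Fin.suc-injective (unique pᵢ pⱼ)) P⇒Q)

Clashing : ∀ {n} (a b : Fin n → ℕ) → Pair n → Set
Clashing a b (u , v) = a u ≡ a v × b u ≤ b v

clashing? : ∀ {n} (a b : Fin n → ℕ) e → Dec (Clashing a b e)
clashing? a b (u , v) = a u ≟ a v ×-dec b u ≤? b v

module _ {r s : ℕ} (J : ℕ) (a b : Fin (size J) → ℕ) (a<r : ∀ v → a v < r) (b<s : ∀ v → b v < s) where

  private
    N = size J
    W = ∑ (pairs J) (λ e → ⟦ clashing? a b e ⟧)

  size≤∑count : N ≤ ∑ (allFin r) (λ i → count a b (toℕ i) 0 s)
  size≤∑count = begin
    N
      ≡⟨ trans (∑-const (allFin N) 1) (trans (*-identityʳ _) (length-tabulate id)) ⟨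
    ∑ (allFin N) (λ _ → 1)
      ≤⟨ ∑-mono (allFin N) ownClass ⟩
    ∑ (allFin N) (λ v → ∑ (allFin r) (λ i → ⟦ inClass? a b (toℕ i) 0 s v ⟧))
      ≡⟨ ∑-swap (allFin N) (allFin r) _ ⟩
    ∑ (allFin r) (λ i → count a b (toℕ i) 0 s) ∎
    where
    open ≤-Reasoning
    ownClass : ∀ v → 1 ≤ ∑ (allFin r) (λ i → ⟦ inClass? a b (toℕ i) 0 s v ⟧)
    ownClass v = ≤-trans
      (≤-reflexive (sym (⟦⟧-yes (inClass? a b _ 0 s v) (sym (Fin.toℕ-fromℕ< (a<r v)) , z≤n , b<s v))))
      (∈⇒≤∑ (∈-allFin (fromℕ< (a<r v))))

  -- A clashing pair has a single common first label, so it is counted for at most one i.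
  ∑clashes≤ : ∑ (allFin r) (λ i → clashes J a b (toℕ i)) ≤ W
  ∑clashes≤ = ≤-trans (≤-reflexive (∑-swap (allFin r) (pairs J) _))
    (∑-mono (pairs J) λ e@(u , v) → ∑-atMostOne {r} (λ i → clashIn? a b (toℕ i) e) (clashing? a b e)
      (λ (au≡i , _) (au≡j , _) → Fin.toℕ-injective (trans (sym au≡i) au≡j))
      (λ (au≡i , av≡i , bu≤bv) → trans au≡i (sym av≡i) , bu≤bv))

  module _ .{{_ : NonZero r}} .{{_ : NonZero J}} (large : 4 * (r * s) ≤ N) where

    private
      instance
        rJ≢0 : NonZero (r * J)
        rJ≢0 = m*n≢0 r J

    -- Sum `class-bound` over the r classes with q = 4rJ. The error r J N² is then a quarter of q
    -- N², and by `large` the interval term r q N s is at most another quarter, which leaves q N² /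
    -- 2 ≤ q² W.
    many-clashes : N * N ≤ 8 * (r * J) * W
    many-clashes = *-cancelˡ-≤ (8 * (r * J)) {{m*n≢0 8 (r * J)}} (+-cancelʳ-≤ (2 * q * N * N) _ _ (begin
      8 * (r * J) * (N * N) + 2 * q * N * N
        ≡⟨ double (r * J) N ⟩
      4 * (q * N * N)
        ≤⟨ *-monoʳ-≤ 4 allClasses ⟩
      4 * (r * (q * N * s + J * (N * N)) + q * q * W)
        ≡⟨ regroup r J q N s W ⟩
      q * N * (4 * (r * s)) + q * N * N + 4 * (q * q * W)
        ≤⟨ +-monoˡ-≤ (4 * (q * q * W)) (+-monoˡ-≤ (q * N * N) (*-monoʳ-≤ (q * N) large)) ⟩
      q * N * N + q * N * N + 4 * (q * q * W)
        ≡⟨ finish (r * J) N W ⟩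
      8 * (r * J) * (8 * (r * J) * W) + 2 * q * N * N ∎))
      where
      open ≤-Reasoning
      q = 4 * (r * J)
      B = q * N * s + J * (N * N)
      c w : Fin r → ℕ
      c i = count a b (toℕ i) 0 s
      w i = clashes J a b (toℕ i)
      perClass : ∀ i → q * N * c i ≤ B + q * q * w i
      perClass i = begin
        q * N * c i                                    ≡⟨ cong (q * N *_) (+-identityʳ (c i)) ⟨
        q * N * (c i + 0)                              ≤⟨ class-bound q (toℕ i) J a b 0 s z≤n ⟩
        q * N * s + q * q * w i + J * (N * N)          ≡⟨ swap (q * N * s) (q * q * w i) (J * (N * N)) ⟩
        B + q * q * w i                                ∎
        where
        swap : ∀ x y z → x + y + z ≡ x + z + y
        swap = solve-∀
      allClasses : q * N * N ≤ r * B + q * q * W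
      allClasses = begin
        q * N * N
          ≤⟨ *-monoʳ-≤ (q * N) size≤∑count ⟩
        q * N * ∑ (allFin r) c
          ≡⟨ ∑-*ˡ (allFin r) (q * N) c ⟨
        ∑ (allFin r) (λ i → q * N * c i)
          ≤⟨ ∑-mono (allFin r) perClass ⟩
        ∑ (allFin r) (λ i → B + q * q * w i)
          ≡⟨ ∑-+ (allFin r) _ _ ⟩
        ∑ (allFin r) (λ _ → B) + ∑ (allFin r) (λ i → q * q * w i)
          ≡⟨ cong₂ _+_ (trans (∑-const (allFin r) B) (cong (_* B) (length-tabulate {n = r} id)))
               (∑-*ˡ (allFin r) (q * q) w) ⟩
        r * B + q * q * ∑ (allFin r) w
          ≤⟨ +-monoʳ-≤ (r * B) (*-monoʳ-≤ (q * q) ∑clashes≤) ⟩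
        r * B + q * q * W ∎
      double : ∀ x N → 8 * x * (N * N) + 2 * (4 * x) * N * N ≡ 4 * (4 * x * N * N)
      double = solve-∀
      regroup : ∀ r J q N s W → 4 * (r * (4 * (r * J) * N * s + J * (N * N)) + q * q * W) ≡
        4 * (r * J) * N * (4 * (r * s)) + 4 * (r * J) * N * N + 4 * (q * q * W)
      regroup = solve-∀
      finish : ∀ x N W → 4 * x * N * N + 4 * x * N * N + 4 * (4 * x * (4 * x) * W) ≡
        8 * x * (8 * x * W) + 2 * (4 * x) * N * N
      finish = solve-∀

    -- The density required by the greedy choice: since the total weight is J N² / 4, clashes make
    -- up at least a 1/(2rJ²) fraction of it.
    length-pairs≤ : length (pairs J) ≤ 2 * (r * J * J) * W
    length-pairs≤ = *-cancelˡ-≤ 4 (begin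
      4 * length (pairs J)              ≡⟨ length-pairs J ⟩
      J * (N * N)                       ≤⟨ *-monoʳ-≤ J many-clashes ⟩
      J * (8 * (r * J) * W)             ≡⟨ regroup r J W ⟩
      4 * (2 * (r * J * J) * W)         ∎)
      where
      open ≤-Reasoning
      regroup : ∀ r J W → J * (8 * (r * J) * W) ≡ 4 * (2 * (r * J * J) * W)
      regroup = solve-∀

-- Labellings are coded by the elements of `Fin ((r * s) ^ N)`. As r s < 2^J, there are fewer than
-- 2^(J N) of them, whence the factor J N in the size of the hitting set.
labellings-hit : ∀ r s J .{{_ : NonZero r}} .{{_ : NonZero s}} .{{_ : NonZero J}} → 4 * (r * s) ≤ size J →
  ∃ λ (S : List (Pair (size J))) → length S ≤ 2 * (r * J * J) * (J * size J) × All (λ (u , v) → u Fin.< v) S ×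
    (∀ (a b : Fin (size J) → ℕ) → (∀ v → a v < r) → (∀ v → b v < s) → Any (Clashing a b) S)
labellings-hit r s J large = S , subst (λ q → length S ≤ q * (J * N)) Q≡ S-small ,
  All.map (All.lookup (pairs-ordered J)) S⊆pairs , hit
  where
  N = size J
  K = (r * s) ^ N
  Q = 2 * (r * J * J)
  instance
    N≢0 : NonZero N
    N≢0 = subst NonZero (sym (size≡2^ J)) (m^n≢0 2 J)
    rs≢0 : NonZero (r * s)
    rs≢0 = m*n≢0 r s
    NN≢0 : NonZero (N * N)
    NN≢0 = m*n≢0 N N
    rJ≢0 : NonZero (r * J)
    rJ≢0 = m*n≢0 r J
    rJJ≢0 : NonZero (r * J * J)
    rJJ≢0 = m*n≢0 (r * J) J
    Q≢0 : NonZero Q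
    Q≢0 = m*n≢0 2 (r * J * J)
  Q≡ : suc (pred Q) ≡ Q
  Q≡ = suc-pred Q
  label : Fin K → Fin N → Fin r × Fin s
  label f v = remQuot s (finToFun f v)
  first second : Fin K → Fin N → ℕ
  first f v = toℕ (proj₁ (label f v))
  second f v = toℕ (proj₂ (label f v))
  nonempty : 0 < length (pairs J)
  nonempty = *-cancelˡ-< 4 0 _ (subst (0 <_) (sym (length-pairs J)) (>-nonZero⁻¹ _ {{m*n≢0 J (N * N)}}))
  open HittingSet (λ f e → clashing? (first f) (second f) e) (pairs J) nonempty (pred Q)
    (λ f → subst (λ q → length (pairs J) ≤ q * ∑ (pairs J) (λ e → ⟦ clashing? (first f) (second f) e ⟧)) (sym Q≡)
      (length-pairs≤ J (first f) (second f) (λ v → Fin.toℕ<n (proj₁ (label f v)))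
        (λ v → Fin.toℕ<n (proj₂ (label f v))) large))
  few : length (allFin K) < 2 ^ (J * N)
  few = begin-strict
    length (allFin K)    ≡⟨ length-tabulate id ⟩
    (r * s) ^ N          <⟨ ^-monoˡ-< N rs<2^J ⟩
    (2 ^ J) ^ N          ≡⟨ ^-*-assoc 2 J N ⟩
    2 ^ (J * N)          ∎
    where
    open ≤-Reasoning
    rs<2^J : r * s < 2 ^ J
    rs<2^J = begin-strict
      r * s          <⟨ m<m*n (r * s) 4 (s≤s (s≤s z≤n)) ⟩
      r * s * 4      ≡⟨ *-comm (r * s) 4 ⟩
      4 * (r * s)    ≤⟨ large ⟩
      N              ≡⟨ size≡2^ J ⟩
      2 ^ J          ∎
  hs = hittingSet (allFin K) (J * N) few
  S = proj₁ hs
  S-small = proj₁ (proj₂ hs)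
  S⊆pairs = proj₁ (proj₂ (proj₂ hs))
  hit : ∀ (a b : Fin N → ℕ) → (∀ v → a v < r) → (∀ v → b v < s) → Any (Clashing a b) S
  hit a b a<r b<s = Any.map (λ {(u , v)} (a≡ , b≤) →
      subst₂ _≡_ (first≡ u) (first≡ v) a≡ , subst₂ _≤_ (second≡ u) (second≡ v) b≤)
    (proj₂ (proj₂ (proj₂ hs)) (∈-allFin f))
    where
    ab : Fin N → Fin (r * s)
    ab v = combine (fromℕ< (a<r v)) (fromℕ< (b<s v))
    f = funToFin ab
    label≡ : ∀ v → label f v ≡ (fromℕ< (a<r v) , fromℕ< (b<s v))
    label≡ v = trans (cong (remQuot s) (Fin.finToFun-funToFin ab v)) (Fin.remQuot-combine (fromℕ< (a<r v)) _)
    first≡ : ∀ v → first f v ≡ a v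
    first≡ v = trans (cong (toℕ ∘ proj₁) (label≡ v)) (Fin.toℕ-fromℕ< (a<r v))
    second≡ : ∀ v → second f v ≡ b v
    second≡ v = trans (cong (toℕ ∘ proj₂) (label≡ v)) (Fin.toℕ-fromℕ< (b<s v))

open MonochromaticPath

-- Walks and monochromatic paths

_≟ᶜ_ : (c d : Colour) → Dec (c ≡ d)
red  ≟ᶜ red  = yes refl
red  ≟ᶜ blue = no λ ()
blue ≟ᶜ red  = no λ ()
blue ≟ᶜ blue = yes refl

module _ {n m : ℕ} (H : OrderedGraph n m) (χ : Fin m → Colour) (c : Colour) where

  source target : Fin m → Fin n
  source e = proj₁ (edge H e)
  target e = proj₂ (edge H e)

  -- Recursion on the first edge makes walks decidable by recursion on the length. Every edge points
  -- upwards, so a walk is automatically an increasing path.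
  Walk : ℕ → Fin n → Set
  Walk zero    v = ⊤
  Walk (suc k) v = ∃ λ e → source e ≡ v × χ e ≡ c × Walk k (target e)

  walk? : ∀ k v → Dec (Walk k v)
  walk? zero    v = yes tt
  walk? (suc k) v = Fin.any? λ e → source e Fin.≟ v ×-dec χ e ≟ᶜ c ×-dec walk? k (target e)

  walk⇒path : ∀ k v → Walk k v → ∃ λ (P : MonochromaticPath H χ c k) → vertex P zero ≡ v
  walk⇒path zero    v tt = record { vertex = λ _ → v ; increasing = λ () ; adjacent = λ () } , refl
  walk⇒path (suc k) v (e , refl , χe≡c , w) with walk⇒path k (target e) w
  ... | P , start = record
    { vertex     = λ { zero → source e ; (suc i) → vertex P i }
    ; increasing = λ { zero → subst (source e Fin.<_) (sym start) (ordered H e) ; (suc i) → increasing P i }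
    ; adjacent   = λ { zero → e , cong (source e ,_) (sym start) , χe≡c ; (suc i) → adjacent P i }
    } , refl

  path⇒walk : ∀ k (P : MonochromaticPath H χ c k) → Walk k (vertex P zero)
  path⇒walk zero    P = tt
  path⇒walk (suc k) P with adjacent P zero
  ... | e , e≡ , χe≡c = e , cong proj₁ e≡ , χe≡c , subst (Walk k) (sym (cong proj₂ e≡)) (path⇒walk k record
    { vertex     = λ i → vertex P (suc i)
    ; increasing = λ i → increasing P (suc i)
    ; adjacent   = λ i → adjacent P (suc i) })

  path? : ∀ k → Dec (MonochromaticPath H χ c k)
  path? k = map′ (λ (v , w) → proj₁ (walk⇒path k v w)) (λ P → vertex P zero , path⇒walk k P) (Fin.any? (walk? k))

  -- Maximality is claimed only up to length R. This suffices, because it is applied to a walk of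
  -- fewer than R steps prolonged by one edge.
  record LongestWalk (R : ℕ) (v : Fin n) : Set where
    field
      steps   : ℕ
      steps<  : steps < R
      walk    : Walk steps v
      maximal : ∀ {j} → j ≤ R → Walk j v → j ≤ steps

  longestWalk : ∀ R v → ¬ Walk R v → LongestWalk R v
  longestWalk zero    v ¬w = contradiction tt ¬w
  longestWalk (suc R) v ¬w with walk? R v
  ... | yes w  = record { steps = R ; steps< = ≤-refl ; walk = w ; maximal = shorter }
    where
    shorter : ∀ {j} → j ≤ suc R → Walk j v → j ≤ R
    shorter j≤ wⱼ with m≤n⇒m<n∨m≡n j≤
    ... | inj₁ j<   = s≤s⁻¹ j<
    ... | inj₂ refl = contradiction wⱼ ¬w
  ... | no ¬w′ = record { steps = steps ; steps< = m<n⇒m<1+n steps< ; walk = walk ; maximal = shorter }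
    where
    open LongestWalk (longestWalk R v ¬w′)
    shorter : ∀ {j} → j ≤ suc R → Walk j v → j ≤ steps
    shorter j≤ wⱼ with m≤n⇒m<n∨m≡n j≤
    ... | inj₁ j<   = maximal (s≤s⁻¹ j<) wⱼ
    ... | inj₂ refl = contradiction wⱼ ¬w

-- Graphs from hitting sets

Unique⇒lookup-injective : {A : Set} {xs : List A} → Unique xs → ∀ i j → lookup xs i ≡ lookup xs j → i ≡ j
Unique⇒lookup-injective (x∉ ∷ u) zero    zero    eq = refl
Unique⇒lookup-injective (x∉ ∷ u) zero    (suc j) eq = contradiction eq (All.lookup x∉ (∈-lookup j))
Unique⇒lookup-injective (x∉ ∷ u) (suc i) zero    eq = contradiction (sym eq) (All.lookup x∉ (∈-lookup i))
Unique⇒lookup-injective (x∉ ∷ u) (suc i) (suc j) eq = cong suc (Unique⇒lookup-injective u i j eq)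

fromPairs : ∀ {n} (S : List (Pair n)) → Unique S → All (λ (u , v) → u Fin.< v) S → OrderedGraph n (length S)
fromPairs S unique increasing = record
  { edge      = lookup S
  ; ordered   = λ e → All.lookup increasing (∈-lookup e)
  ; injective = Unique⇒lookup-injective unique _ _ }

-- Label each vertex by the lengths of the longest red and blue walks leaving it: no edge can clash.
clash⇒Arrows : ∀ {n m} (H : OrderedGraph n m) r s →
  (∀ (a b : Fin n → ℕ) → (∀ v → a v < r) → (∀ v → b v < s) → ∃ λ e → Clashing a b (edge H e)) → Arrows H r s
clash⇒Arrows {n} H r s clash χ with Fin.any? (walk? H χ red r) | Fin.any? (walk? H χ blue s)
... | yes (v , w) | _           = inj₁ (proj₁ (walk⇒path H χ red r v w))
... | no _        | yes (v , w) = inj₂ (proj₁ (walk⇒path H χ blue s v w))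
... | no ¬red     | no ¬blue    = contradiction (proj₂ clashing) (noClash (proj₁ clashing))
  where
  longestRed : ∀ v → LongestWalk H χ red r v
  longestRed v = longestWalk H χ red r v (λ w → ¬red (v , w))
  longestBlue : ∀ v → LongestWalk H χ blue s v
  longestBlue v = longestWalk H χ blue s v (λ w → ¬blue (v , w))
  open module Red v = LongestWalk (longestRed v) using () renaming (steps to a; steps< to a<r)
  open module Blue v = LongestWalk (longestBlue v) using () renaming (steps to b; steps< to b<s)
  clashing = clash a b a<r b<s
  noClash : ∀ e → ¬ Clashing a b (edge H e)
  noClash e (a≡ , b≤) = byColour (χ e) refl
    where
    byColour : ∀ c → χ e ≡ c → ⊥
    -- A red edge put before the longest red walk from its target gives a longer one from its
    -- source, so a strictly decreases along it; likewise b along a blue edge. Either contradicts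
    -- the clash.
    byColour red  χe = <⇒≱ (s≤s (≤-reflexive a≡)) (Red.maximal _ (a<r _) (e , refl , χe , Red.walk _))
    byColour blue χe = <⇒≱ (s≤s b≤) (Blue.maximal _ (b<s _) (e , refl , χe , Blue.walk _))

-- Multiplicities served only as weights, so repetitions are removed from the hitting set to obtain
-- a simple graph.
upperGraph : ∀ r s J .{{_ : NonZero r}} .{{_ : NonZero s}} .{{_ : NonZero J}} → 4 * (r * s) ≤ size J →
  ∃ λ m → m ≤ 2 * (r * J * J) * (J * size J) × SomeGraphArrows r s m
upperGraph r s J large =
  length S′ , ≤-trans (length-deduplicate _≟ᵖ_ S) (proj₁ (proj₂ found)) , size J , H , clash⇒Arrows H r s clash
  where
  found = labellings-hit r s J large
  S = proj₁ found
  _≟ᵖ_ : (p q : Pair (size J)) → Dec (p ≡ q)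
  _≟ᵖ_ = ≡-dec Fin._≟_ Fin._≟_
  S′ = deduplicate _≟ᵖ_ S
  H = fromPairs S′ (UniqueDec.deduplicate-! _≟ᵖ_ S) (All.deduplicate⁺ _≟ᵖ_ (proj₁ (proj₂ (proj₂ found))))
  clash : ∀ (a b : Fin (size J) → ℕ) → (∀ v → a v < r) → (∀ v → b v < s) → ∃ λ e → Clashing a b (edge H e)
  clash a b a<r b<s = Any.index p∈S′ , subst (Clashing a b) (lookup-index p∈S′) (proj₂ (proj₂ hit))
    where
    hit = find (proj₂ (proj₂ (proj₂ found)) a b a<r b<s)
    p∈S′ = ∈-deduplicate⁺ _≟ᵖ_ (proj₁ (proj₂ hit))

-- Decidability and the minimum

module _ {n : ℕ} where

  -- Repeated entries are harmless: ranks need not be consecutive, but on members of the list they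
  -- are strictly increasing and stay below its length.
  rank : List (Fin n) → Fin n → ℕ
  rank xs v = ∑ xs (λ x → ⟦ x Fin.<? v ⟧)

  rank-mono-< : ∀ {xs u v} → u ∈ xs → u Fin.< v → rank xs u < rank xs v
  rank-mono-< {u = u} {v} u∈xs u<v = ∑-mono-<
    (λ x → ⟦⟧-mono (x Fin.<? u) (x Fin.<? v) (λ x<u → <-trans x<u u<v)) u∈xs
    (subst₂ _<_ (sym (⟦⟧-no (u Fin.<? u) (<-irrefl refl))) (sym (⟦⟧-yes (u Fin.<? v) u<v)) (s≤s z≤n))

  rank-< : ∀ {xs v} → v ∈ xs → rank xs v < length xs
  rank-< {xs} {v} v∈xs = <-≤-trans
    (∑-mono-< {g = λ _ → 1} (λ x → ⟦⟧≤1 (x Fin.<? v)) v∈xs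
      (subst (_< 1) (sym (⟦⟧-no (v Fin.<? v) (<-irrefl refl))) (s≤s z≤n)))
    (≤-reflexive (trans (∑-const xs 1) (*-identityʳ (length xs))))

  rank-injective : ∀ {xs u v} → u ∈ xs → v ∈ xs → rank xs u ≡ rank xs v → u ≡ v
  rank-injective {u = u} {v} u∈ v∈ eq with Fin.<-cmp u v
  ... | tri< u<v _ _ = contradiction (rank-mono-< u∈ u<v) (<-irrefl eq)
  ... | tri≈ _ u≡v _ = u≡v
  ... | tri> _ _ v<u = contradiction (rank-mono-< v∈ v<u) (<-irrefl (sym eq))

-- Deleting the isolated vertices leaves at most two vertices per edge.
module Compress {n m : ℕ} (H : OrderedGraph n m) where

  private
    sources targets ends : List (Fin n)
    sources = map (λ e → proj₁ (edge H e)) (allFin m)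
    targets = map (λ e → proj₂ (edge H e)) (allFin m)
    ends    = sources ++ targets

    length-map-allFin : ∀ {A : Set} (f : Fin m → A) → length (map f (allFin m)) ≡ m
    length-map-allFin f = trans (length-map f (allFin m)) (length-tabulate {n = m} id)

    length-ends : length ends ≡ m + m
    length-ends = trans (length-++ sources {targets}) (cong₂ _+_ (length-map-allFin _) (length-map-allFin _))

    source∈ : ∀ e → proj₁ (edge H e) ∈ ends
    source∈ e = ∈-++⁺ˡ (∈-map⁺ _ (∈-allFin e))

    target∈ : ∀ e → proj₂ (edge H e) ∈ ends
    target∈ e = ∈-++⁺ʳ sources (∈-map⁺ _ (∈-allFin e))

    relabel : ∀ {v} → v ∈ ends → Fin (m + m)
    relabel {v} v∈ = fromℕ< (subst (rank ends v <_) length-ends (rank-< v∈))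

    toℕ-relabel : ∀ {v} (v∈ : v ∈ ends) → toℕ (relabel v∈) ≡ rank ends v
    toℕ-relabel v∈ = Fin.toℕ-fromℕ< _

    relabel-injective : ∀ {u v} (u∈ : u ∈ ends) (v∈ : v ∈ ends) → relabel u∈ ≡ relabel v∈ → u ≡ v
    relabel-injective u∈ v∈ eq = rank-injective u∈ v∈
      (trans (sym (toℕ-relabel u∈)) (trans (cong toℕ eq) (toℕ-relabel v∈)))

    relabel-irrelevant : ∀ {u v} (u∈ : u ∈ ends) (v∈ : v ∈ ends) → u ≡ v → relabel u∈ ≡ relabel v∈
    relabel-irrelevant u∈ v∈ refl = Fin.toℕ-injective (trans (toℕ-relabel u∈) (sym (toℕ-relabel v∈)))

  compressed : OrderedGraph (m + m) m
  compressed = record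
    { edge      = λ e → relabel (source∈ e) , relabel (target∈ e)
    ; ordered   = λ e → subst₂ _<_ (sym (toℕ-relabel (source∈ e))) (sym (toℕ-relabel (target∈ e)))
        (rank-mono-< (source∈ e) (ordered H e))
    ; injective = λ {e} {e′} eq → injective H (cong₂ _,_
        (relabel-injective (source∈ e) (source∈ e′) (cong proj₁ eq))
        (relabel-injective (target∈ e) (target∈ e′) (cong proj₂ eq))) }

  private
    walk : ∀ χ c k {v} (v∈ : v ∈ ends) → Walk H χ c k v → Walk compressed χ c k (relabel v∈)
    walk χ c zero    v∈ w = w
    walk χ c (suc k) v∈ (e , s≡v , χe≡c , w) =
      e , relabel-irrelevant (source∈ e) v∈ s≡v , χe≡c , walk χ c k (target∈ e) w

    -- With k nonzero the path starts at an end of an edge; a path without edges could sit at a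
    -- deleted vertex.
    path : ∀ χ c k .{{_ : NonZero k}} → MonochromaticPath H χ c k → MonochromaticPath compressed χ c k
    path χ c k@(suc _) P with path⇒walk H χ c k P
    ... | w@(e , s≡v , _) = proj₁ (walk⇒path compressed χ c k _ (walk χ c k (subst (_∈ ends) s≡v (source∈ e)) w))

  compressed-Arrows : ∀ r s .{{_ : NonZero r}} .{{_ : NonZero s}} → Arrows H r s → Arrows compressed r s
  compressed-Arrows r s arrows χ = Sum.map (path χ red r) (path χ blue s) (arrows χ)

-- Pointwise hypotheses, because colourings and edge maps rebuilt from vectors agree with the
-- originals pointwise.
MonochromaticPath-cong : ∀ {n m} {H H′ : OrderedGraph n m} {χ χ′ c k} →
  (∀ e → edge H e ≡ edge H′ e) → (∀ e → χ e ≡ χ′ e) → MonochromaticPath H χ c k → MonochromaticPath H′ χ′ c k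
MonochromaticPath-cong H≡ χ≡ P = record
  { vertex     = vertex P
  ; increasing = increasing P
  ; adjacent   = λ i → let e , edge≡ , χe≡c = adjacent P i in
      e , trans (sym (H≡ e)) edge≡ , trans (sym (χ≡ e)) χe≡c }

Arrows-cong : ∀ {n m} {H H′ : OrderedGraph n m} {r s} → (∀ e → edge H e ≡ edge H′ e) → Arrows H r s → Arrows H′ r s
Arrows-cong {H = H} {H′} H≡ arrows χ = Sum.map
  (MonochromaticPath-cong {H = H} {H′} H≡ (λ _ → refl))
  (MonochromaticPath-cong {H = H} {H′} H≡ (λ _ → refl)) (arrows χ)

Searchable : Set → Set₁
Searchable A = ∀ {P : A → Set} → (∀ x → Dec (P x)) → Dec (∃ P)

search-Pair : ∀ {n} → Searchable (Pair n)
search-Pair P? = map′ (λ (u , v , p) → (u , v) , p) (λ ((u , v) , p) → u , v , p)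
  (Fin.any? λ u → Fin.any? λ v → P? (u , v))

search-Colour : Searchable Colour
search-Colour {P} P? = map′ [ red ,_ , blue ,_ ] (λ { (red , p) → inj₁ p ; (blue , p) → inj₂ p })
  (P? red ⊎-dec P? blue)

search-Vec : ∀ {A} → Searchable A → ∀ k → Searchable (Vec A k)
search-Vec searchA zero    P? = map′ ([] ,_) (λ { ([] , p) → p }) (P? [])
search-Vec searchA (suc k) P? = map′ (λ (x , xs , p) → x ∷ xs , p) (λ { (x ∷ xs , p) → x , xs , p })
  (searchA λ x → search-Vec searchA k λ xs → P? (x ∷ xs))

-- Search for a colouring without either path. Its absence yields arrowing, since for each single
-- colouring the existence of a path is decidable and double negation can be removed.
arrows? : ∀ {n m} (H : OrderedGraph n m) r s → Dec (Arrows H r s)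
arrows? {n} {m} H r s = map′ toArrows fromArrows (¬? (search-Vec search-Colour m λ χ → ¬? (hasPath? χ)))
  where
  HasPath : Vec Colour m → Set
  HasPath χ = MonochromaticPath H (Vec.lookup χ) red r ⊎ MonochromaticPath H (Vec.lookup χ) blue s
  hasPath? : ∀ χ → Dec (HasPath χ)
  hasPath? χ = path? H (Vec.lookup χ) red r ⊎-dec path? H (Vec.lookup χ) blue s
  toArrows : ¬ ∃ (λ χ → ¬ HasPath χ) → Arrows H r s
  toArrows ¬∃ χ = Sum.map same same
    (decidable-stable (hasPath? (Vec.tabulate χ)) λ ¬path → ¬∃ (Vec.tabulate χ , ¬path))
    where
    same : ∀ {c k} → MonochromaticPath H (Vec.lookup (Vec.tabulate χ)) c k → MonochromaticPath H χ c k
    same = MonochromaticPath-cong {H = H} {H} (λ _ → refl) (lookup∘tabulate χ)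
  fromArrows : Arrows H r s → ¬ ∃ (λ χ → ¬ HasPath χ)
  fromArrows arrows (χ , ¬path) = ¬path (arrows (Vec.lookup χ))

-- Compression allows the vertex set to be fixed as `Fin (m + m)`, which leaves finitely many edge
-- vectors to test.
someGraphArrows? : ∀ r s .{{_ : NonZero r}} .{{_ : NonZero s}} m → Dec (SomeGraphArrows r s m)
someGraphArrows? r s m = map′
  (λ (es , ok , arrows) → m + m , graph es ok , arrows)
  (λ (_ , H , arrows) → fromGraph (Compress.compressed H) (Compress.compressed-Arrows H r s arrows))
  (search-Vec search-Pair m good?)
  where
  IsGraph : Vec (Pair (m + m)) m → Set
  IsGraph es = (∀ e → proj₁ (Vec.lookup es e) Fin.< proj₂ (Vec.lookup es e)) ×
               (∀ e e′ → Vec.lookup es e ≡ Vec.lookup es e′ → e ≡ e′)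
  isGraph? : ∀ es → Dec (IsGraph es)
  isGraph? es = Fin.all? (λ e → proj₁ (Vec.lookup es e) Fin.<? proj₂ (Vec.lookup es e)) ×-dec
    Fin.all? (λ e → Fin.all? λ e′ → ≡-dec Fin._≟_ Fin._≟_ (Vec.lookup es e) (Vec.lookup es e′) →-dec e Fin.≟ e′)
  graph : ∀ es → IsGraph es → OrderedGraph (m + m) m
  graph es (ord , inj) = record { edge = Vec.lookup es ; ordered = ord ; injective = inj _ _ }
  good? : ∀ es → Dec (Σ (IsGraph es) λ ok → Arrows (graph es ok) r s)
  good? es with isGraph? es
  ... | no ¬ok = no λ (ok , _) → ¬ok ok
  ... | yes ok = map′ (ok ,_)
    (λ (ok′ , arrows) → Arrows-cong {H = graph es ok′} {graph es ok} (λ _ → refl) arrows)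
    (arrows? (graph es ok) r s)
  fromGraph : ∀ H → Arrows H r s → ∃ λ es → Σ (IsGraph es) λ ok → Arrows (graph es ok) r s
  fromGraph H arrows = es , ok , Arrows-cong {H = H} {graph es ok} (λ e → sym (look e)) arrows
    where
    es = Vec.tabulate (edge H)
    look : ∀ e → Vec.lookup es e ≡ edge H e
    look = lookup∘tabulate (edge H)
    ok : IsGraph es
    ok = (λ e → subst (λ p → proj₁ p Fin.< proj₂ p) (sym (look e)) (ordered H e)) ,
         (λ e e′ eq → injective H (trans (sym (look e)) (trans eq (look e′))))

least : {P : ℕ → Set} → (∀ k → Dec (P k)) → ∀ {M} → P M → ∃ λ m → m ≤ M × P m × (∀ k → P k → m ≤ k)
least {P} P? {M} pM = fromBelow (below (suc M))
  where
  Least : ℕ → Set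
  Least b = ∃ λ m → m < b × P m × (∀ k → P k → m ≤ k)
  below : ∀ b → Least b ⊎ (∀ k → P k → b ≤ k)
  below zero = inj₂ λ _ _ → z≤n
  below (suc b) with below b
  ... | inj₁ (m , m<b , rest) = inj₁ (m , m<n⇒m<1+n m<b , rest)
  ... | inj₂ b≤ with P? b
  ...   | yes pb = inj₁ (b , ≤-refl , pb , b≤)
  ...   | no ¬pb = inj₂ λ k pk → ≤∧≢⇒< (b≤ k pk) (λ { refl → ¬pb pk })
  fromBelow : Least (suc M) ⊎ (∀ k → P k → suc M ≤ k) → ∃ λ m → m ≤ M × P m × (∀ k → P k → m ≤ k)
  fromBelow (inj₁ (m , m<1+M , rest)) = m , s≤s⁻¹ m<1+M , rest
  fromBelow (inj₂ M<)                 = contradiction (M< M pM) 1+n≰n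

-- The lower bound

walk-climbs : ∀ {n m} (H : OrderedGraph n m) χ c {R} (f : Fin n → ℕ) → (∀ v → f v < R) →
  (∀ e → χ e ≡ c → f (proj₁ (edge H e)) < f (proj₂ (edge H e))) → ∀ k v → Walk H χ c k v → f v + k < R
walk-climbs H χ c {R} f f<R climbs zero v w = subst (_< R) (sym (+-identityʳ (f v))) (f<R v)
walk-climbs H χ c {R} f f<R climbs (suc k) v (e , refl , χe≡c , w) =
  ≤-<-trans (≤-trans (≤-reflexive (+-suc (f v) k)) (+-monoˡ-≤ k (climbs e χe≡c)))
    (walk-climbs H χ c f f<R climbs k (proj₂ (edge H e)) w)

-- Colour an edge red if a increases along it and blue otherwise, when b must increase. A red P_r
-- would need r + 1 values of a, and a blue P_s would need s + 1 values of b.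
labelling⇒¬Arrows : ∀ {n m} (H : OrderedGraph n m) {r s} (a b : Fin n → ℕ) → (∀ v → a v < r) → (∀ v → b v < s) →
  (∀ e → let u , v = edge H e in a u < a v ⊎ b u < b v) → ¬ Arrows H r s
labelling⇒¬Arrows {n} {m} H {r} {s} a b a<r b<s climbs arrows =
  [ noPath red r a a<r redClimbs , noPath blue s b b<s blueClimbs ] (arrows χ)
  where
  colour : ∀ e → Dec (a (proj₁ (edge H e)) < a (proj₂ (edge H e)))
  colour e = a (proj₁ (edge H e)) <? a (proj₂ (edge H e))
  choose : ∀ {P : Set} → Dec P → Colour
  choose (yes _) = red
  choose (no _)  = blue
  χ : Fin m → Colour
  χ e = choose (colour e)
  redClimbs : ∀ e → χ e ≡ red → a (proj₁ (edge H e)) < a (proj₂ (edge H e))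
  redClimbs e χe with colour e
  ... | yes a< = a<
  blueClimbs : ∀ e → χ e ≡ blue → b (proj₁ (edge H e)) < b (proj₂ (edge H e))
  blueClimbs e χe with colour e | climbs e
  ... | no _  | inj₂ b< = b<
  ... | no a≮ | inj₁ a< = contradiction a< a≮
  noPath : ∀ c R (f : Fin n → ℕ) → (∀ v → f v < R) → (∀ e → χ e ≡ c → f (proj₁ (edge H e)) < f (proj₂ (edge H e))) →
    ¬ MonochromaticPath H χ c R
  noPath c R f f<R fClimbs P = <⇒≱ (walk-climbs H χ c f f<R fClimbs R _ (path⇒walk H χ c R P)) (m≤n+m R _)

-- Deleting vertices of high degree and colouring the rest greedily.

_∈?_ : ∀ {n} (x : Fin n) xs → Dec (x ∈ xs)
x ∈? xs = Any.any? (x Fin.≟_) xs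

-- Pigeonhole: if every colour occurred, sending it to a position in the list would be an injection
-- into a smaller set.
fresh : ∀ {k} (xs : List (Fin k)) → length xs < k → ∃ (_∉ xs)
fresh {k} xs ∣xs∣<k with Fin.any? (λ x → ¬? (x ∈? xs))
... | yes found = found
... | no ¬found = contradiction ∣xs∣<k (≤⇒≯ (Fin.injective⇒≤ position-injective))
  where
  everywhere : ∀ x → x ∈ xs
  everywhere x with x ∈? xs
  ... | yes x∈ = x∈
  ... | no x∉  = contradiction (x , x∉) ¬found
  position-injective : ∀ {x y} → index (everywhere x) ≡ index (everywhere y) → x ≡ y
  position-injective {x} {y} eq = trans (lookup-index (everywhere x))
    (trans (cong (lookup xs) eq) (sym (lookup-index (everywhere y))))

module _ {n : ℕ} where

  Touches : Fin n → Pair n → Set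
  Touches v (u , w) = u ≡ v ⊎ w ≡ v

  touches? : ∀ v e → Dec (Touches v e)
  touches? v (u , w) = u Fin.≟ v ⊎-dec w Fin.≟ v

  degree : List (Pair n) → Fin n → ℕ
  degree E v = ∑ E (λ e → ⟦ touches? v e ⟧)

  record Peeling (k : ℕ) (E : List (Pair n)) : Set where
    field
      hubs   : List (Fin n)
      rest   : List (Pair n)
      few    : length hubs * k ≤ length E
      covers : ∀ {e} → e ∈ E → e ∈ rest ⊎ Any (λ h → Touches h e) hubs
      sparse : ∀ v → degree rest v < k

  -- While some vertex has degree at least k, delete it. Each deletion removes at least k edges,
  -- which bounds the number of hubs and lets the edge count serve as fuel.
  peel : ∀ k .{{_ : NonZero k}} fuel E → length E ≤ fuel → Peeling k E
  peel k fuel E ∣E∣≤ with Fin.any? (λ v → k ≤? degree E v)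
  ... | no ¬dense = record
    { hubs = [] ; rest = E ; few = z≤n ; covers = inj₁ ; sparse = λ v → ≰⇒> (λ dense → ¬dense (v , dense)) }
  peel k zero    []  _    | yes (v , k≤0) = contradiction k≤0 (<⇒≱ (>-nonZero⁻¹ k))
  peel k (suc fuel) E ∣E∣≤ | yes (v , k≤deg) = record
    { hubs = v ∷ hubs ; rest = rest ; few = few′ ; covers = covers′ ; sparse = sparse }
    where
    E₁ = filter (λ e → ¬? (touches? v e)) E
    E₁+k≤E : length E₁ + k ≤ length E
    E₁+k≤E = ≤-trans (+-monoʳ-≤ (length E₁) k≤deg) (≤-reflexive (∑-filter (touches? v) E))
    E₁≤fuel : length E₁ ≤ fuel
    E₁≤fuel = s≤s⁻¹ (≤-trans (m<m+n (length E₁) (>-nonZero⁻¹ k)) (≤-trans E₁+k≤E ∣E∣≤))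
    open Peeling (peel k fuel E₁ E₁≤fuel)
    few′ : k + length hubs * k ≤ length E
    few′ = ≤-trans (≤-reflexive (+-comm k _)) (≤-trans (+-monoˡ-≤ k few) E₁+k≤E)
    covers′ : ∀ {e} → e ∈ E → e ∈ rest ⊎ Any (λ h → Touches h e) (v ∷ hubs)
    covers′ {e} e∈E with touches? v e
    ... | yes t = inj₂ (here t)
    ... | no ¬t with covers (∈-filter⁺ (λ e → ¬? (touches? v e)) e∈E ¬t)
    ...   | inj₁ e∈rest = inj₁ e∈rest
    ...   | inj₂ hub    = inj₂ (there hub)

  module _ {k : ℕ} .{{_ : NonZero k}} (E : List (Pair n)) (sparse : ∀ v → degree E v < k) where

    private
      ProperOn : List (Fin n) → (Fin n → Fin k) → Set
      ProperOn vs c = ∀ {u w} → (u , w) ∈ E → u ≢ w → u ∈ vs → w ∈ vs → c u ≢ c w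

      tail∈ : ∀ {x v : Fin n} {vs} → x ∈ v ∷ vs → x ≢ v → x ∈ vs
      tail∈ (here x≡v)  x≢v = contradiction x≡v x≢v
      tail∈ (there x∈) _   = x∈

      -- Fewer than k edges touch v, so their opposite ends leave one of the k colours free for v.
      extend : ∀ v vs → ∃ (ProperOn vs) → ∃ (ProperOn (v ∷ vs))
      extend v vs (c , proper) = c′ , proper′
        where
        opposing : Pair n → Fin k
        opposing (u , w) with u Fin.≟ v
        ... | yes _ = c w
        ... | no  _ = c u
        forbidden = map opposing (filter (touches? v) E)
        free = fresh forbidden (subst (_< k)
          (sym (trans (length-map opposing (filter (touches? v) E)) (length-filter≡∑ (touches? v) E))) (sparse v))
        x = proj₁ free
        c′ : Fin n → Fin k
        c′ = updateAt c v (const x)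
        c′v≡x : c′ v ≡ x
        c′v≡x = updateAt-updates v c
        avoids : ∀ {e} → e ∈ E → Touches v e → opposing e ≢ x
        avoids e∈ t eq = proj₂ free (subst (_∈ forbidden) eq (∈-map⁺ opposing (∈-filter⁺ (touches? v) e∈ t)))
        opposing-source : ∀ {w} → opposing (v , w) ≡ c w
        opposing-source with v Fin.≟ v
        ... | yes _   = refl
        ... | no v≢v = contradiction refl v≢v
        opposing-target : ∀ {u w} → u ≢ v → opposing (u , w) ≡ c u
        opposing-target {u} u≢v with u Fin.≟ v
        ... | yes u≡v = contradiction u≡v u≢v
        ... | no _    = refl
        proper′ : ProperOn (v ∷ vs) c′
        proper′ {u} {w} e∈ u≢w u∈ w∈ eq with u Fin.≟ v | w Fin.≟ v
        ... | yes refl | yes refl = u≢w refl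
        ... | yes refl | no w≢v   = avoids e∈ (inj₁ refl)
          (trans opposing-source (trans (sym (updateAt-minimal w v c w≢v)) (trans (sym eq) c′v≡x)))
        ... | no u≢v   | yes refl = avoids e∈ (inj₂ refl)
          (trans (opposing-target u≢v) (trans (sym (updateAt-minimal u v c u≢v)) (trans eq c′v≡x)))
        ... | no u≢v   | no w≢v   = proper e∈ u≢w (tail∈ u∈ u≢v) (tail∈ w∈ w≢v)
          (trans (sym (updateAt-minimal u v c u≢v)) (trans eq (updateAt-minimal w v c w≢v)))

      colourAll : ∀ vs → ∃ (ProperOn vs)
      colourAll []       = (λ _ → Fin.fromℕ< (>-nonZero⁻¹ k)) , λ _ _ ()
      colourAll (v ∷ vs) = extend v vs (colourAll vs)

    greedyColouring : ∃ λ (c : Fin n → Fin k) → ∀ {u w} → (u , w) ∈ E → u ≢ w → c u ≢ c w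
    greedyColouring = let c , proper = colourAll (allFin n) in
      c , λ e∈ u≢w → proper e∈ u≢w (∈-allFin _) (∈-allFin _)

-- The hubs, at most p t of them, get increasing labels in lexicographic order inside [0, p) × [k, k + t);
-- the other vertices get labels on the antichain {(p + i, k - 1 - i)}, every element of which is
-- incomparable with the labels of the hubs.
few-edges⇒¬Arrows : ∀ {n m} (H : OrderedGraph n m) k p t .{{_ : NonZero k}} .{{_ : NonZero p}} →
  m < suc (p * t) * k → ¬ Arrows H (p + k) (k + t)
few-edges⇒¬Arrows {n} {m} H k p t m< = labelling⇒¬Arrows H a b a< b< climbs
  where
  E = map (edge H) (allFin m)
  ∣E∣≡m : length E ≡ m
  ∣E∣≡m = trans (length-map (edge H) (allFin m)) (length-tabulate {n = m} id)
  open Peeling (peel k (length E) E ≤-refl)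
  c = proj₁ (greedyColouring rest sparse)
  fewHubs : length hubs ≤ p * t
  fewHubs = s≤s⁻¹ (*-cancelʳ-< k _ _ (≤-<-trans few (subst (_< suc (p * t) * k) (sym ∣E∣≡m) m<)))
  label : ∀ v → Dec (v ∈ hubs) → ℕ × ℕ
  label v (yes _) = rank hubs v % p , k + rank hubs v ℕ./ p
  label v (no _)  = p + toℕ (c v) , toℕ (opposite (c v))
  a b : Fin n → ℕ
  a v = proj₁ (label v (v ∈? hubs))
  b v = proj₂ (label v (v ∈? hubs))
  a< : ∀ v → a v < p + k
  a< v with v ∈? hubs
  ... | yes _ = <-≤-trans (m%n<n (rank hubs v) p) (m≤m+n p k)
  ... | no _  = +-monoʳ-< p (Fin.toℕ<n (c v))
  b< : ∀ v → b v < k + t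
  b< v with v ∈? hubs
  ... | yes v∈ = +-monoʳ-< k (m<n*o⇒m/o<n (<-≤-trans (rank-< v∈) (≤-trans fewHubs (≤-reflexive (*-comm p t)))))
  ... | no _   = <-≤-trans (Fin.toℕ<n (opposite (c v))) (m≤m+n k t)
  -- The quotient is the leading coordinate; where quotients agree, the remainder increases.
  lexicographic : ∀ x y → x < y → x % p < y % p ⊎ k + x ℕ./ p < k + y ℕ./ p
  lexicographic x y x<y with m≤n⇒m<n∨m≡n (/-monoˡ-≤ p (<⇒≤ x<y))
  ... | inj₁ x/p<y/p = inj₂ (+-monoʳ-< k x/p<y/p)
  ... | inj₂ x/p≡y/p = inj₁ (+-cancelʳ-< (x ℕ./ p * p) _ _ (subst₂ _<_ (m≡m%n+[m/n]*n x p)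
          (trans (m≡m%n+[m/n]*n y p) (cong (λ z → y % p + z * p) (sym x/p≡y/p))) x<y))
  antichain : ∀ (i j : Fin k) → i ≢ j → p + toℕ i < p + toℕ j ⊎ toℕ (opposite i) < toℕ (opposite j)
  antichain i j i≢j with Fin.<-cmp i j
  ... | tri< i<j _ _ = inj₁ (+-monoʳ-< p i<j)
  ... | tri≈ _ i≡j _ = contradiction i≡j i≢j
  ... | tri> _ _ j<i = inj₂ (subst₂ _<_ (sym (Fin.opposite-prop i)) (sym (Fin.opposite-prop j))
          (∸-monoʳ-< (s≤s j<i) (Fin.toℕ<n i)))
  climbs : ∀ e → let u , v = edge H e in a u < a v ⊎ b u < b v
  climbs e = byMembership (u ∈? hubs) (v ∈? hubs)
    where
    u = proj₁ (edge H e)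
    v = proj₂ (edge H e)
    byMembership : (u? : Dec (u ∈ hubs)) (v? : Dec (v ∈ hubs)) →
      proj₁ (label u u?) < proj₁ (label v v?) ⊎ proj₂ (label u u?) < proj₂ (label v v?)
    byMembership (yes u∈) (yes v∈) = lexicographic _ _ (rank-mono-< u∈ (ordered H e))
    -- Hubs have a < p and b ≥ k, the other vertices a ≥ p and b < k: a increases when a hub comes
    -- first, b when a hub comes second.
    byMembership (yes u∈) (no _)   = inj₁ (<-≤-trans (m%n<n (rank hubs u) p) (m≤m+n p _))
    byMembership (no _)   (yes v∈) = inj₂ (<-≤-trans (Fin.toℕ<n (opposite (c u))) (m≤m+n k _))
    byMembership (no u∉)  (no v∉)  = antichain (c u) (c v)
      (proj₂ (greedyColouring rest sparse) e∈rest (Fin.<⇒≢ (ordered H e)))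
      where
      noHub : ∀ {hs} → u ∉ hs → v ∉ hs → ¬ Any (λ h → Touches h (u , v)) hs
      noHub u∉ v∉ (here (inj₁ u≡)) = u∉ (here u≡)
      noHub u∉ v∉ (here (inj₂ v≡)) = v∉ (here v≡)
      noHub u∉ v∉ (there hub)      = noHub (u∉ ∘ there) (v∉ ∘ there) hub
      e∈rest : (u , v) ∈ rest
      e∈rest with covers (∈-map⁺ (edge H) (∈-allFin e))
      ... | inj₁ e∈  = e∈
      ... | inj₂ hub = contradiction hub (noHub u∉ v∉)

halves : ∀ r → ∃ λ k → r ≡ k + k ⊎ r ≡ suc k + k
halves zero = 0 , inj₁ refl
halves (suc r) with halves r
... | k , inj₁ refl = k , inj₂ refl
... | k , inj₂ refl = suc k , inj₁ (cong suc (sym (+-suc k k)))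

-- Take k = ⌊r/2⌋, p = r - k and t = s - k. For even r, k ≤ s/2 already gives p t k ≥ (r/2)² (s/2) =
-- r² s / 8. In `even` and `odd` the extra summand is the slack, a polynomial with natural
-- coefficients.
lowerBound : ∀ r s m → 2 ≤ r → r ≤ s → SomeGraphArrows r s m → r ^ 2 * s ≤ 8 * m
lowerBound r s m 2≤r r≤s (n , H , arrows) with m≤n⇒∃[o]m+o≡n r≤s | halves r
... | d , refl | zero  , inj₁ refl = contradiction 2≤r λ ()
... | d , refl | zero  , inj₂ refl = contradiction 2≤r λ { (s≤s ()) }
... | d , refl | suc j , inj₁ refl = ≮⇒≥ λ 8m< → few-edges⇒¬Arrows H (suc j) (suc j) (suc j + d)
    (*-cancelˡ-< 8 _ _ (<-≤-trans 8m< (≤-trans (m≤m+n _ _) (≤-reflexive (even j d)))))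
    (subst (Arrows H (suc j + suc j)) (+-assoc (suc j) (suc j) d) arrows)
  where
  even : ∀ j d → (suc j + suc j) * ((suc j + suc j) * 1) * (suc j + suc j + d) +
                   (4 * (suc j * suc j) * d + 8 * suc j) ≡
                 8 * (suc (suc j * (suc j + d)) * suc j)
  even = solve-∀
... | d , refl | suc j , inj₂ refl = ≮⇒≥ λ 8m< → few-edges⇒¬Arrows H (suc j) (suc (suc j)) (suc (suc j) + d)
    (*-cancelˡ-< 8 _ _ (<-≤-trans 8m< (≤-trans (m≤m+n _ _) (≤-reflexive (odd j d)))))
    (subst (Arrows H (suc (suc j) + suc j)) (shift j d) arrows)
  where
  odd : ∀ j d → (suc (suc j) + suc j) * ((suc (suc j) + suc j) * 1) * (suc (suc j) + suc j + d) +
                  (4 * (j * j) + 18 * j + 13 + d * (4 * (j * j) + 12 * j + 7)) ≡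
                8 * (suc (suc (suc j) * (suc (suc j) + d)) * suc j)
  odd = solve-∀
  shift : ∀ j d → suc (suc j) + suc j + d ≡ suc j + (suc (suc j) + d)
  shift = solve-∀

-- Rational estimates of the logarithm

/-mono-≤ : ∀ a b c d .{{_ : NonZero b}} .{{_ : NonZero d}} → a * d ≤ c * b → + a / b ℚ.≤ + c / d
/-mono-≤ a b@(suc _) c d@(suc _) ad≤cb = ℚ.toℚᵘ-cancel-≤ (begin
  ℚ.toℚᵘ (+ a / b)  ≃⟨ ℚ.toℚᵘ-fromℚᵘ (+ a ℚᵘ./ b) ⟩
  + a ℚᵘ./ b        ≤⟨ ℚᵘ.*≤* (subst₂ ℤ._≤_ (ℤ.pos-* a d) (ℤ.pos-* c b) (ℤ.+≤+ ad≤cb)) ⟩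
  + c ℚᵘ./ d        ≃⟨ ℚ.toℚᵘ-fromℚᵘ (+ c ℚᵘ./ d) ⟨
  ℚ.toℚᵘ (+ c / d)  ∎)
  where open ℚᵘ.≤-Reasoning

/-* : ∀ a b c d .{{_ : NonZero b}} .{{_ : NonZero d}} .{{_ : NonZero (b * d)}} →
  (+ a / b) ℚ.* (+ c / d) ≡ + (a * c) / (b * d)
/-* a b@(suc _) c d@(suc _) = ℚ.toℚᵘ-injective (begin-equality
  ℚ.toℚᵘ ((+ a / b) ℚ.* (+ c / d))              ≃⟨ ℚ.toℚᵘ-homo-* (+ a / b) (+ c / d) ⟩
  ℚ.toℚᵘ (+ a / b) ℚᵘ.* ℚ.toℚᵘ (+ c / d)        ≃⟨ ℚᵘ.*-cong (ℚ.toℚᵘ-fromℚᵘ (+ a ℚᵘ./ b)) (ℚ.toℚᵘ-fromℚᵘ (+ c ℚᵘ./ d)) ⟩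
  (+ a ℚᵘ./ b) ℚᵘ.* (+ c ℚᵘ./ d)                ≡⟨ cong (λ z → z ℚᵘ./ (b * d)) (ℤ.pos-* a c) ⟨
  + (a * c) ℚᵘ./ (b * d)                        ≃⟨ ℚ.toℚᵘ-fromℚᵘ (+ (a * c) ℚᵘ./ (b * d)) ⟨
  ℚ.toℚᵘ (+ (a * c) / (b * d))                  ∎)
  where open ℚᵘ.≤-Reasoning

/-+ : ∀ a c b .{{_ : NonZero b}} → (+ a / b) ℚ.+ (+ c / b) ≡ + (a + c) / b
/-+ a c b@(suc _) = ℚ.toℚᵘ-injective (begin-equality
  ℚ.toℚᵘ ((+ a / b) ℚ.+ (+ c / b))              ≃⟨ ℚ.toℚᵘ-homo-+ (+ a / b) (+ c / b) ⟩
  ℚ.toℚᵘ (+ a / b) ℚᵘ.+ ℚ.toℚᵘ (+ c / b)        ≃⟨ ℚᵘ.+-cong (ℚ.toℚᵘ-fromℚᵘ (+ a ℚᵘ./ b)) (ℚ.toℚᵘ-fromℚᵘ (+ c ℚᵘ./ b)) ⟩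
  (+ a ℚᵘ./ b) ℚᵘ.+ (+ c ℚᵘ./ b)                ≃⟨ ℚᵘ.*≡* cross ⟩
  + (a + c) ℚᵘ./ b                              ≃⟨ ℚ.toℚᵘ-fromℚᵘ (+ (a + c) ℚᵘ./ b) ⟨
  ℚ.toℚᵘ (+ (a + c) / b)                        ∎)
  where
  open ℚᵘ.≤-Reasoning
  cross : (+ a ℤ.* + b ℤ.+ + c ℤ.* + b) ℤ.* + b ≡ + (a + c) ℤ.* + (b * b)
  cross = trans (cong (ℤ._* + b) (sym (ℤ.*-distribʳ-+ (+ b) (+ a) (+ c))))
    (trans (ℤ.*-assoc (+ (a + c)) (+ b) (+ b)) (cong (+ (a + c) ℤ.*_) (sym (ℤ.pos-* b b))))

0≤/ : ∀ a b .{{_ : NonZero b}} → 0ℚ ℚ.≤ + a / b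
0≤/ a b = /-mono-≤ 0 1 a b z≤n

*-mono-≤-nonNeg : ∀ {p q p′ q′} → 0ℚ ℚ.≤ p → 0ℚ ℚ.≤ q′ → p ℚ.≤ p′ → q ℚ.≤ q′ → p ℚ.* q ℚ.≤ p′ ℚ.* q′
*-mono-≤-nonNeg {p} {q} {p′} {q′} 0≤p 0≤q′ p≤p′ q≤q′ = ℚ.≤-trans
  (ℚ.*-monoˡ-≤-nonNeg p {{ℚ.nonNegative 0≤p}} q≤q′) (ℚ.*-monoʳ-≤-nonNeg q′ {{ℚ.nonNegative 0≤q′}} p≤p′)

-- The aim is log s ≥ (i + 2)/4 for 2^(i + 1) ≤ s: among the first s/2 terms the series for log s
-- dominates half of the harmonic series.
module LogBound (p : ℕ) where

  private
    s = suc p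
    x = + p / s
    t = logTerm p
    S = logPartialSum p

  0≤x^ : ∀ k → 0ℚ ℚ.≤ x ^ℚ k
  0≤x^ zero    = ℚ.nonNegative⁻¹ 1ℚ
  0≤x^ (suc k) = *-mono-≤-nonNeg {0ℚ} {0ℚ} ℚ.≤-refl (0≤x^ k) (0≤/ p s) (0≤x^ k)

  0≤term : ∀ k → 0ℚ ℚ.≤ t k
  0≤term k = *-mono-≤-nonNeg {0ℚ} {0ℚ} ℚ.≤-refl (0≤/ 1 (suc k)) (0≤x^ (suc k)) (0≤/ 1 (suc k))

  -- Bernoulli's inequality (1 - 1/s)ᵏ ≥ 1 - k/s, with d = s - k.
  power-bound : ∀ k d → k + d ≡ s → + d / s ℚ.≤ x ^ℚ k
  power-bound zero    d refl = /-mono-≤ s s 1 1 (≤-reflexive (*-comm s 1))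
  power-bound (suc k) d eq = begin
    + d / s                     ≤⟨ /-mono-≤ d s (p * suc d) (s * s) cross ⟩
    + (p * suc d) / (s * s)     ≡⟨ /-* p s (suc d) s ⟨
    x ℚ.* (+ suc d / s)         ≤⟨ ℚ.*-monoˡ-≤-nonNeg x {{ℚ.nonNegative (0≤/ p s)}}
                                     (power-bound k (suc d) (trans (+-suc k d) eq)) ⟩
    x ℚ.* (x ^ℚ k)              ∎
    where
    open ℚ.≤-Reasoning
    d≤p : d ≤ p
    d≤p = subst (d ≤_) (suc-injective eq) (m≤n+m d k)
    cross : d * (s * s) ≤ p * suc d * s
    cross = ≤-trans (≤-reflexive (sym (*-assoc d s s))) (*-monoˡ-≤ s
      (≤-trans (≤-reflexive (*-suc d p)) (≤-trans (+-monoˡ-≤ (d * p) d≤p)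
        (≤-reflexive (trans (cong (p ℕ.+_) (*-comm d p)) (sym (*-suc p d)))))))

  -- With d = s - (k + 1), the hypothesis gives s ≤ 2d, so the power in the term is at least d/s ≥
  -- 1/2 by Bernoulli's inequality.
  term-bound : ∀ k → 2 * suc k ≤ s → + 1 / (2 * suc k) ℚ.≤ t k
  term-bound k 2k≤s with m≤n⇒∃[o]m+o≡n (≤-trans (m≤n*m (suc k) 2) 2k≤s)
  ... | d , eq = begin
    + 1 / (2 * suc k)                 ≤⟨ /-mono-≤ 1 (2 * suc k) (d * 1) (s * suc k) cross ⟩
    + (d * 1) / (s * suc k)           ≡⟨ /-* d s 1 (suc k) ⟨
    (+ d / s) ℚ.* (+ 1 / suc k)       ≤⟨ ℚ.*-monoʳ-≤-nonNeg (+ 1 / suc k) {{ℚ.nonNegative (0≤/ 1 (suc k))}}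
                                           (power-bound (suc k) d eq) ⟩
    t k                               ∎
    where
    open ℚ.≤-Reasoning
    k<d : suc k ≤ d
    k<d = +-cancelˡ-≤ (suc k) _ _ (≤-trans
      (≤-reflexive (cong (suc k ℕ.+_) (sym (+-identityʳ (suc k))))) (≤-trans 2k≤s (≤-reflexive (sym eq))))
    s≤2d : s ≤ 2 * d
    s≤2d = ≤-trans (≤-reflexive (sym eq)) (≤-trans (+-monoˡ-≤ d k<d)
      (≤-reflexive (cong (d ℕ.+_) (sym (+-identityʳ d)))))
    cross : 1 * (s * suc k) ≤ d * 1 * (2 * suc k)
    cross = ≤-trans (≤-reflexive (*-identityˡ (s * suc k)))
      (≤-trans (*-monoˡ-≤ (suc k) s≤2d) (≤-reflexive (regroup d (suc k))))
      where
      regroup : ∀ d k → 2 * d * k ≡ d * 1 * (2 * k)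
      regroup = solve-∀

  sum-step : ∀ n → S n ℚ.≤ S (suc n)
  sum-step n = ℚ.≤-trans (ℚ.≤-reflexive (sym (ℚ.+-identityʳ (S n)))) (ℚ.+-monoʳ-≤ (S n) (0≤term n))

  sum-mono : ∀ {m n} → m ≤′ n → S m ℚ.≤ S n
  sum-mono ≤′-refl               = ℚ.≤-refl
  sum-mono (≤′-step {n} m≤n) = ℚ.≤-trans (sum-mono m≤n) (sum-step n)

  -- Each dyadic block of terms 2ⁱ ≤ k < 2ⁱ⁺¹ contributes at least 1/4.
  block : ∀ i .{{_ : NonZero (4 * 2 ^ i)}} → 4 * 2 ^ i ≤ s → + (i + 2) / 4 ℚ.≤ S (2 ^ i) →
    ∀ m → m ≤ 2 ^ i → + (2 ^ i * (i + 2) + m) / (4 * 2 ^ i) ℚ.≤ S (m + 2 ^ i)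
  block i 4·2^i≤s base zero _ = ℚ.≤-trans
    (/-mono-≤ (2 ^ i * (i + 2) + 0) (4 * 2 ^ i) (i + 2) 4 (≤-reflexive (regroup (2 ^ i) (i + 2)))) base
    where
    regroup : ∀ a b → (a * b + 0) * 4 ≡ b * (4 * a)
    regroup = solve-∀
  block i 4·2^i≤s base (suc m) m<2^i = begin
    + (2 ^ i * (i + 2) + suc m) / D
      ≡⟨ cong (λ z → + z / D) (trans (cong (2 ^ i * (i + 2) ℕ.+_) (+-comm 1 m))
           (sym (+-assoc (2 ^ i * (i + 2)) m 1))) ⟩
    + (2 ^ i * (i + 2) + m + 1) / D
      ≡⟨ /-+ (2 ^ i * (i + 2) + m) 1 D ⟨
    (+ (2 ^ i * (i + 2) + m) / D) ℚ.+ (+ 1 / D)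
      ≤⟨ ℚ.+-mono-≤ (block i 4·2^i≤s base m (<⇒≤ m<2^i)) (ℚ.≤-trans
           (/-mono-≤ 1 D 1 (2 * suc k) (*-monoʳ-≤ 1 2k≤D)) (term-bound k (≤-trans 2k≤D 4·2^i≤s))) ⟩
    S k ℚ.+ t k ∎
    where
    open ℚ.≤-Reasoning
    D = 4 * 2 ^ i
    k = m + 2 ^ i
    2k≤D : 2 * suc k ≤ D
    2k≤D = ≤-trans (*-monoʳ-≤ 2 (+-monoˡ-≤ (2 ^ i) m<2^i)) (≤-reflexive (double (2 ^ i)))
      where
      double : ∀ a → 2 * (a + a) ≡ 4 * a
      double = solve-∀

  -- The term of index 0 supplies 2/4, and each of the i dyadic blocks adds 1/4.
  sum-bound : ∀ i → 2 * 2 ^ i ≤ s → + (i + 2) / 4 ℚ.≤ S (2 ^ i)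
  sum-bound zero    2≤s = ℚ.≤-trans (/-mono-≤ 2 4 1 2 ≤-refl)
    (ℚ.≤-trans (term-bound 0 2≤s) (ℚ.≤-reflexive (sym (ℚ.+-identityˡ (t 0)))))
  sum-bound (suc i) 4·2^i≤s = ℚ.≤-trans
    (/-mono-≤ (suc i + 2) 4 (2 ^ i * (i + 2) + 2 ^ i) (4 * 2 ^ i) (≤-reflexive (regroup (2 ^ i) i)))
    (subst (λ n → + (2 ^ i * (i + 2) + 2 ^ i) / (4 * 2 ^ i) ℚ.≤ S n)
      (cong (2 ^ i ℕ.+_) (sym (+-identityʳ (2 ^ i))))
      (block i D≤s (sum-bound i (≤-trans (*-monoʳ-≤ 2 (m≤n*m (2 ^ i) 2)) 4·2^i≤s)) (2 ^ i) ≤-refl))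
    where
    instance
      2^i≢0 : NonZero (2 ^ i)
      2^i≢0 = m^n≢0 2 i
      D≢0 : NonZero (4 * 2 ^ i)
      D≢0 = m*n≢0 4 (2 ^ i)
    D≤s : 4 * 2 ^ i ≤ s
    D≤s = ≤-trans (≤-reflexive (*-assoc 2 2 (2 ^ i))) 4·2^i≤s
    regroup : ∀ a i → (suc i + 2) * (4 * a) ≡ (a * (i + 2) + a) * 4
    regroup = solve-∀

  log-bound : ∀ i → 2 * 2 ^ i ≤ s → ∀ n → 2 ^ i ≤ n → + (i + 2) / 4 ℚ.≤ S n
  log-bound i 2^≤s n 2^≤n = ℚ.≤-trans (sum-bound i 2^≤s) (sum-mono (≤⇒≤′ 2^≤n))

-- Passage to inequalities between real numbers.

≤ℚ⇒≤ℝ : ∀ x y N → (∀ n → N ≤ n → seq x n ℚ.≤ seq y n) → x ≤ℝ y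
≤ℚ⇒≤ℝ x y N x≤y ε 0<ε = N , λ n N≤n → ℚ.≤-trans (x≤y n N≤n)
  (ℚ.≤-trans (ℚ.≤-reflexive (sym (ℚ.+-identityʳ (seq y n)))) (ℚ.+-monoʳ-≤ (seq y n) (ℚ.<⇒≤ 0<ε)))

lower-real : ∀ R m → R ≤ 8 * m → fromℚ (+ 1 / 8) *ℝ fromℕ R ≤ℝ fromℕ m
lower-real R m R≤8m = ≤ℚ⇒≤ℝ (fromℚ (+ 1 / 8) *ℝ fromℕ R) (fromℕ m) 0 λ _ _ → ℚ.≤-trans (ℚ.≤-reflexive (/-* 1 8 R 1))
  (/-mono-≤ (1 * R) (8 * 1) m 1 (subst₂ _≤_ (sym (trans (*-identityʳ (1 * R)) (*-identityˡ R))) (*-comm 8 m) R≤8m))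

^ℚ-nonNeg : ∀ {q} k → 0ℚ ℚ.≤ q → 0ℚ ℚ.≤ q ^ℚ k
^ℚ-nonNeg zero    0≤q = ℚ.nonNegative⁻¹ 1ℚ
^ℚ-nonNeg (suc k) 0≤q = *-mono-≤-nonNeg {0ℚ} {0ℚ} ℚ.≤-refl (^ℚ-nonNeg k 0≤q) 0≤q (^ℚ-nonNeg k 0≤q)

^ℚ-mono : ∀ {q q′} k → 0ℚ ℚ.≤ q → q ℚ.≤ q′ → q ^ℚ k ℚ.≤ q′ ^ℚ k
^ℚ-mono zero    0≤q q≤q′ = ℚ.≤-refl
^ℚ-mono (suc k) 0≤q q≤q′ = *-mono-≤-nonNeg 0≤q (^ℚ-nonNeg k (ℚ.≤-trans 0≤q q≤q′)) q≤q′ (^ℚ-mono k 0≤q q≤q′)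

/-^ℚ : ∀ a b k .{{_ : NonZero b}} .{{_ : NonZero (b ^ k)}} → (+ a / b) ^ℚ k ≡ + (a ^ k) / (b ^ k)
/-^ℚ a b zero    = refl
/-^ℚ a b (suc k) = trans (cong ((+ a / b) ℚ.*_) (/-^ℚ a b k)) (/-* a b (a ^ k) (b ^ k))
  where
  instance
    b^k≢0 : NonZero (b ^ k)
    b^k≢0 = m^n≢0 b k

-- Replacing i + 2 by 4 log s costs the factor 4³ = 64. The comparison holds for every partial sum
-- from index 2^i on.
upper-real : ∀ c R m s i → 2 * 2 ^ i ≤ s → m ≤ c * (R * (i + 2) ^ 3) →
  fromℕ m ≤ℝ fromℕ (64 * c) *ℝ fromℕ R *ℝ log s ^ℝ 3
-- The junk value `log zero` is excluded by the lower bound on s.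
upper-real c R m zero    i 2^≤s _ = contradiction (≤-trans (*-mono-≤ (s≤s {n = 1} z≤n) (m^n>0 2 i)) 2^≤s) λ ()
upper-real c R m (suc p) i 2^≤s m≤ = ≤ℚ⇒≤ℝ (fromℕ m) (fromℕ (64 * c) *ℝ fromℕ R *ℝ log (suc p) ^ℝ 3) (2 ^ i)
  λ n 2^≤n → begin
  + m / 1
    ≤⟨ /-mono-≤ m 1 (64 * c * R * l ^ 3) (1 * 1 * 4 ^ 3)
         (≤-trans (*-monoˡ-≤ 64 m≤) (≤-reflexive (regroup c R (l ^ 3) 64))) ⟩
  + (64 * c * R * l ^ 3) / (1 * 1 * 4 ^ 3)
    ≡⟨ /-* (64 * c * R) (1 * 1) (l ^ 3) (4 ^ 3) ⟨
  (+ (64 * c * R) / (1 * 1)) ℚ.* (+ (l ^ 3) / (4 ^ 3))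
    ≡⟨ cong₂ ℚ._*_ (/-* (64 * c) 1 R 1) (/-^ℚ l 4 3) ⟨
  (+ (64 * c) / 1) ℚ.* (+ R / 1) ℚ.* ((+ l / 4) ^ℚ 3)
    ≤⟨ ℚ.*-monoˡ-≤-nonNeg CR {{ℚ.nonNegative 0≤CR}} (^ℚ-mono 3 (0≤/ l 4) (LogBound.log-bound p i 2^≤s n 2^≤n)) ⟩
  (+ (64 * c) / 1) ℚ.* (+ R / 1) ℚ.* (logPartialSum p n ^ℚ 3) ∎
  where
  open ℚ.≤-Reasoning
  l = i + 2
  CR = (+ (64 * c) / 1) ℚ.* (+ R / 1)
  0≤CR : 0ℚ ℚ.≤ CR
  0≤CR = *-mono-≤-nonNeg {0ℚ} {0ℚ} ℚ.≤-refl (0≤/ R 1) (0≤/ (64 * c) 1) (0≤/ R 1)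
  regroup : ∀ c R L k → c * (R * L) * k ≡ k * c * R * L * 1
  regroup = solve-∀

-- Choice of the dyadic depth and conclusion.

⌊log₂⌋-bounds : ∀ x .{{_ : NonZero x}} → ∃ λ l → 2 ^ l ≤ x × x < 2 ^ suc l
⌊log₂⌋-bounds (suc zero)      = 0 , ≤-refl , ≤-refl
⌊log₂⌋-bounds (suc x@(suc _)) with ⌊log₂⌋-bounds x
... | l , 2^l≤x , x<2^1+l with m≤n⇒m<n∨m≡n x<2^1+l
...   | inj₁ 1+x<2^1+l = l , m≤n⇒m≤1+n 2^l≤x , 1+x<2^1+l
...   | inj₂ 1+x≡2^1+l = suc l , ≤-reflexive (sym 1+x≡2^1+l) ,
  subst (_< 2 ^ suc (suc l)) (sym 1+x≡2^1+l) (^-monoʳ-< 2 ≤-refl {suc l} ≤-refl)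

^-cancelʳ-< : ∀ b {m n} .{{_ : NonZero b}} → b ^ m < b ^ n → m < n
^-cancelʳ-< b b^m<b^n = ≰⇒> λ n≤m → <⇒≱ b^m<b^n (^-monoʳ-≤ b n≤m)

-- Choose J with 4rs < 2^J ≤ 8rs and put l = i + 2, so that s < 2^l. Then J ≤ 2 + 2l ≤ 3l, and the
-- edge bound 2rJ³ 2^J is at most 16 r² s (3l)³, where 16 · 27 = 432.
upperBound : ∀ r s → 2 ≤ r → r ≤ s → ∃ λ i → 2 * 2 ^ i ≤ s ×
  ∃ λ m → m ≤ 432 * (r ^ 2 * s * (i + 2) ^ 3) × SomeGraphArrows r s m
upperBound r@(suc _) s@(suc _) 2≤r r≤s with ⌊log₂⌋-bounds s | ⌊log₂⌋-bounds (4 * (r * s))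
... | zero  , _      , s<2     | _ = contradiction (≤-trans 2≤r r≤s) (<⇒≱ s<2)
... | suc i , 2^1+i≤s , s<2^2+i | e , 2^e≤4rs , 4rs<2^J =
  i , 2^1+i≤s , proj₁ graph , ≤-trans (proj₁ (proj₂ graph)) size≤ , proj₂ (proj₂ graph)
  where
  J = suc e
  graph = upperGraph r s J (≤-trans (<⇒≤ 4rs<2^J) (≤-reflexive (sym (size≡2^ J))))
  size-J≤ : size J ≤ 2 * (4 * (r * s))
  size-J≤ = ≤-trans (≤-reflexive (size≡2^ J)) (*-monoʳ-≤ 2 2^e≤4rs)
  l = i + 2
  l≡ : suc (suc i) ≡ l
  l≡ = +-comm 2 i
  open ≤-Reasoning
  e< : e < 2 + (l + l)
  e< = ^-cancelʳ-< 2 (begin-strict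
    2 ^ e                    ≤⟨ 2^e≤4rs ⟩
    4 * (r * s)              <⟨ *-monoʳ-< 4 (*-mono-< (≤-<-trans r≤s s<2^l) s<2^l) ⟩
    4 * (2 ^ l * 2 ^ l)      ≡⟨ cong (4 *_) (^-distribˡ-+-* 2 l l) ⟨
    4 * 2 ^ (l + l)          ≡⟨ *-assoc 2 2 (2 ^ (l + l)) ⟩
    2 ^ (2 + (l + l))        ∎)
    where
    s<2^l : s < 2 ^ l
    s<2^l = subst (λ z → s < 2 ^ z) l≡ s<2^2+i
  J≤3l : J ≤ 3 * l
  J≤3l = ≤-trans e< (≤-trans (+-monoˡ-≤ (l + l) (m≤n+m 2 i)) (≤-reflexive (triple l)))
    where
    triple : ∀ l → l + (l + l) ≡ 3 * l
    triple = solve-∀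
  size≤ : 2 * (r * J * J) * (J * size J) ≤ 432 * (r ^ 2 * s * l ^ 3)
  size≤ = begin
    2 * (r * J * J) * (J * size J)                      ≤⟨ *-monoʳ-≤ (2 * (r * J * J)) (*-monoʳ-≤ J size-J≤) ⟩
    2 * (r * J * J) * (J * (2 * (4 * (r * s))))         ≡⟨ gather r s J ⟩
    16 * (r ^ 2 * s) * (J * (J * J))
      ≤⟨ *-monoʳ-≤ (16 * (r ^ 2 * s)) (*-mono-≤ J≤3l (*-mono-≤ J≤3l J≤3l)) ⟩
    16 * (r ^ 2 * s) * (3 * l * (3 * l * (3 * l)))      ≡⟨ cubes (r ^ 2 * s) l ⟩
    432 * (r ^ 2 * s * l ^ 3)                           ∎
    where
    gather : ∀ r s J → 2 * (r * J * J) * (J * (2 * (4 * (r * s)))) ≡ 16 * (r * (r * 1) * s) * (J * (J * J))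
    gather = solve-∀
    cubes : ∀ R l → 16 * R * (3 * l * (3 * l * (3 * l))) ≡ 432 * (R * (l * (l * (l * 1))))
    cubes = solve-∀

theorem1p1 : Σ ℝ λ C → (fromℕ 0 <ℝ C) ×
    ((r s : ℕ) → 2 ≤ r → r ≤ s →
    ∃ λ (m : ℕ) → IsOrderedSizeRamsey r s m ×
    (fromℚ (+ 1 / 8) *ℝ fromℕ (r ^ 2 * s) ≤ℝ fromℕ m) ×
    (fromℕ m ≤ℝ C *ℝ fromℕ (r ^ 2 * s) *ℝ log s ^ℝ 3))
-- 432 comes from the constructed graph and 64 = 4³ from the logarithm estimate.
theorem1p1 = fromℕ (64 * 432) , positive , bounds
  where
  positive : fromℕ 0 <ℝ fromℕ (64 * 432)
  positive = 1ℚ , ℚ.positive⁻¹ 1ℚ , 0 , λ _ _ → ℚ.≤-trans (ℚ.≤-reflexive (ℚ.+-identityˡ 1ℚ))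
    (/-mono-≤ 1 1 (64 * 432) 1 (s≤s z≤n))
  bounds : (r s : ℕ) → 2 ≤ r → r ≤ s → ∃ λ (m : ℕ) → IsOrderedSizeRamsey r s m ×
    (fromℚ (+ 1 / 8) *ℝ fromℕ (r ^ 2 * s) ≤ℝ fromℕ m) ×
    (fromℕ m ≤ℝ fromℕ (64 * 432) *ℝ fromℕ (r ^ 2 * s) *ℝ log s ^ℝ 3)
  bounds r@(suc _) s@(suc _) 2≤r r≤s =
    let i , 2^1+i≤s , M , M≤ , arrowsM = upperBound r s 2≤r r≤s
        m , m≤M , arrows , minimal     = least (someGraphArrows? r s) arrowsM
    in m , (arrows , minimal) , lower-real (r ^ 2 * s) m (lowerBound r s m 2≤r r≤s arrows) ,
       upper-real 432 (r ^ 2 * s) m s i 2^1+i≤s (≤-trans m≤M M≤)
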